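{- There is an absolute constant $c>0$ such that for all sufficiently large $d$ and every integer $\Delta$ with $1\le\Delta\le\log_2 d$, every syntactic multilinear $(\Sigma\Pi)^{\Delta}\Sigma$ formula computing $\mathrm{IMM}_d$ has size at least $2^{c\,\Delta d^{1/\Delta}}$.
   Context: Let $\mathbb{F}$ be an arbitrary field. For $i\in[d]$ let $X^{(i)}=\{x^{(i)}_{j,k}: j,k\in\{1,2\}\}$ be disjoint sets of variables, $M^{(i)}$ the $2\times2$ matrix with $(j,k)$ entry $x^{(i)}_{j,k}$, $M=M^{(1)}\cdots M^{(d)}$, and $\mathrm{IMM}_d=M(1,1)+M(1,2)$. Formulas have sum and product gates of unbounded fan-in; size is the number of gates including input gates. A formula is syntactic multilinear if for every product gate, the sets of variables appearing in the subformulas of its children are pairwise disjoint. A $(\Sigma\Pi)^{\Delta}\Sigma$ formula is one whose output gate is a sum gate and in which, along every path from output to inputs, sum and product gates alternate, with exactly $\Delta$ product gates, and the bottom gate (just above the inputs) is a sum gate. -}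

module Defs where

open import Level using (Level; _⊔_) renaming (suc to lsuc)
open import Algebra.Bundles using (CommutativeRing)
open import Data.Nat using (ℕ; zero; suc; _∸_; _≟_) renaming (_+_ to _ℕ+_)
open import Data.Fin using (Fin; combine)
open import Data.List using (List; []; _∷_; map; concatMap; upTo)
open import Data.List.Relation.Unary.All using (All)
open import Data.List.Relation.Unary.Any using (Any)
open import Data.List.Relation.Unary.AllPairs using (AllPairs)
open import Data.Vec using (Vec; []; _∷_; replicate; zipWith; _[_]≔_)
open import Data.Vec.Properties using (≡-dec)
open import Data.Product using (Σ; _×_)
open import Data.Empty using (⊥)
open import Relation.Nullary using (¬_; yes; no)

record Field (a ℓ : Level) : Set (lsuc (a ⊔ ℓ)) where
  field
    commutativeRing : CommutativeRing a ℓ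
  open CommutativeRing commutativeRing public
  field
    1≉0     : ¬ (1# ≈ 0#)
    inverse : ∀ x → ¬ (x ≈ 0#) → Σ Carrier (λ y → (x * y) ≈ 1#)

module _ {a ℓ : Level} (F : Field a ℓ) where
  open Field F using (Carrier; _≈_; _+_; _*_; 0#; 1#)

  data Formula (n : ℕ) : Set a where
    var   : Fin n → Formula n
    const : Carrier → Formula n
    sumG  : List (Formula n) → Formula n
    prodG : List (Formula n) → Formula n

  mutual
    size : ∀ {n} → Formula n → ℕ
    size (var _)    = 1
    size (const _)  = 1
    size (sumG gs)  = suc (sizes gs)
    size (prodG gs) = suc (sizes gs)

    sizes : ∀ {n} → List (Formula n) → ℕ
    sizes []       = 0
    sizes (g ∷ gs) = size g ℕ+ sizes gs

  data Occurs {n : ℕ} (i : Fin n) : Formula n → Set a where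
    here  : Occurs i (var i)
    inSum  : ∀ {gs} → Any (Occurs i) gs → Occurs i (sumG gs)
    inProd : ∀ {gs} → Any (Occurs i) gs → Occurs i (prodG gs)

  VarDisjoint : ∀ {n} → Formula n → Formula n → Set a
  VarDisjoint g h = ∀ i → Occurs i g → Occurs i h → ⊥

  data SynMultilinear {n : ℕ} : Formula n → Set a where
    var   : ∀ i → SynMultilinear (var i)
    const : ∀ c → SynMultilinear (const c)
    sumG  : ∀ {gs} → All SynMultilinear gs → SynMultilinear (sumG gs)
    prodG : ∀ {gs} → All SynMultilinear gs → AllPairs VarDisjoint gs →
            SynMultilinear (prodG gs)

  data IsInput {n : ℕ} : Formula n → Set a where
    var   : ∀ i → IsInput (var i)
    const : ∀ c → IsInput (const c)

  mutual
    data SigmaPiSigma {n : ℕ} : ℕ → Formula n → Set a where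
      bottom : ∀ {gs} → All IsInput gs → SigmaPiSigma zero (sumG gs)
      layer  : ∀ {k gs} → All (PiLayer k) gs → SigmaPiSigma (suc k) (sumG gs)

    data PiLayer {n : ℕ} (k : ℕ) : Formula n → Set a where
      prodG : ∀ {hs} → All (SigmaPiSigma k) hs → PiLayer k (prodG hs)

  -- The (formal) polynomial computed by a formula, given by its
  -- coefficient function on monomials = exponent vectors in ℕ^n.

  Monomial : ℕ → Set
  Monomial n = Vec ℕ n

  below : ∀ {n} → Monomial n → List (Monomial n)
  below []       = [] ∷ []
  below (x ∷ xs) = concatMap (λ e → map (e ∷_) (below xs)) (upTo (suc x))

  sumF : List Carrier → Carrier
  sumF []       = 0#
  sumF (x ∷ xs) = x + sumF xs

  unitMon : ∀ {n} → Fin n → Monomial n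
  unitMon i = replicate _ 0 [ i ]≔ 1

  monCoeff : ∀ {n} → Monomial n → Monomial n → Carrier
  monCoeff e m with ≡-dec _≟_ m e
  ... | yes _ = 1#
  ... | no  _ = 0#

  mutual
    coeff : ∀ {n} → Formula n → Monomial n → Carrier
    coeff (var i)    m = monCoeff (unitMon i) m
    coeff (const c)  m = c * monCoeff (replicate _ 0) m
    coeff (sumG gs)  m = coeffSum gs m
    coeff (prodG gs) m = coeffProd gs m

    coeffSum : ∀ {n} → List (Formula n) → Monomial n → Carrier
    coeffSum []       m = 0#
    coeffSum (g ∷ gs) m = coeff g m + coeffSum gs m

    coeffProd : ∀ {n} → List (Formula n) → Monomial n → Carrier
    coeffProd []       m = monCoeff (replicate _ 0) m
    coeffProd (g ∷ gs) m =
      sumF (map (λ m₁ → coeff g m₁ * coeffProd gs (zipWith _∸_ m m₁)) (below m))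

  SamePoly : ∀ {n} → Formula n → Formula n → Set ℓ
  SamePoly f g = ∀ m → coeff f m ≈ coeff g m

  -- IMM_d.  Variables x^{(i)}_{j,k} (i ∈ [d], j,k ∈ {1,2}) are encoded
  -- as the variable index combine i (combine j k) : Fin (d * (2 * 2)),
  -- with Fin 2 = {0,1} standing for {1,2}.

  Mat : ℕ → Set a
  Mat n = Fin 2 → Fin 2 → Formula n

  x : ∀ {d} → Fin d → Fin 2 → Fin 2 → Formula (d Data.Nat.* (2 Data.Nat.* 2))
  x i j k = var (combine i (combine j k))

  _⊗_ : ∀ {n} → Mat n → Mat n → Mat n
  (A ⊗ B) j k = sumG (prodG (A j Fin.zero ∷ B Fin.zero k ∷ [])
                    ∷ prodG (A j (Fin.suc Fin.zero) ∷ B (Fin.suc Fin.zero) k ∷ [])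
                    ∷ [])
    where import Data.Fin as Fin

  idMat : ∀ {n} → Mat n
  idMat Fin.zero Fin.zero = const 1#
  idMat (Fin.suc Fin.zero) (Fin.suc Fin.zero) = const 1#
  idMat _ _ = const 0#
    where import Data.Fin as Fin

  prodMats : ∀ {d} → List (Fin d) → Mat (d Data.Nat.* (2 Data.Nat.* 2))
  prodMats []       = idMat
  prodMats (i ∷ is) = x i ⊗ prodMats is

  IMMMat : ∀ d → Mat (d Data.Nat.* (2 Data.Nat.* 2))
  IMMMat d = prodMats (Data.List.allFin d)

  IMM : ∀ d → Formula (d Data.Nat.* (2 Data.Nat.* 2))
  IMM d = sumG (IMMMat d Fin.zero Fin.zero ∷ IMMMat d Fin.zero (Fin.suc Fin.zero) ∷ [])
    where import Data.Fin as Fin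

  Computes : ∀ {n} → Formula n → Formula n → Set ℓ
  Computes f p = SamePoly f p

{-# OPTIONS --safe #-}

-- Only the d variables x^(i)_{1,1} matter.  For a set A of them, keep those in A alive, split them into
-- row and column variables, set all other variables to constants, and consider the rank of the resulting
-- 0/1 evaluation matrix.  For every A some choice turns IMM_d into ∏ (1 + y z), of full rank 2^⌊|A|/2⌋.
--
-- For uniformly random A, a product of t factors in disjoint variables loses a constant factor of rank,
-- relative to 2^(|A|/2), at each factor whose share of A is odd, whatever the row/column split; these
-- parities are independent, so the expected relative rank decays exponentially in t.  Inside a formula of
-- product depth Δ one keeps the trivial bound for all factors of a product gate but the one with the most
-- variables and expands that one further.  At the bottom, products of linear forms have expected relative
-- rank exponentially small in their number of variables.  If t₁, …, t_{Δ−1} are the numbers of parts along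
-- the way and t_Δ is the saving at the bottom, then ∏ tᵢ ≥ d/8, so the total saving t_Δ + Σ (tᵢ − 1) is
-- Ω(Δ d^{1/Δ}).  Since relative rank is subadditive, its expectation for the formula is at most the size
-- times 2^(−Ω(Δ d^{1/Δ})).

module Submission where

open import Defs
open import Level using (Level; _⊔_)
open import Data.Nat as ℕ using (ℕ; zero; suc; z≤n; s≤s; _∸_; ⌊_/2⌋)
import Data.Nat.Properties as ℕₚ
open import Data.Nat.DivMod using (_/_; _%_; m≡m%n+[m/n]*n; m%n<n; m/n*n≤m; m≥n⇒m/n>0)
open import Data.Nat.Solver using (module +-*-Solver)
open import Data.Bool using (Bool; true; false; not; _∧_; _∨_; if_then_else_)
open import Data.Bool.Properties using (∧-identityʳ)
open import Data.Empty using (⊥; ⊥-elim)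
open import Data.Fin as Fin using (Fin; zero; suc; combine; remQuot; _↑ˡ_; _↑ʳ_; splitAt; punchIn)
open import Data.Fin.Properties using (remQuot-combine; combine-remQuot; join-splitAt; splitAt-↑ˡ; splitAt-↑ʳ)
open import Data.List as List using (List; []; _∷_; _++_; applyUpTo; concatMap; length)
open import Data.List.Properties using (map-∘; length-++; length-map)
open import Data.List.Relation.Unary.All as All using (All; []; _∷_)
open import Data.List.Relation.Unary.All.Properties using (map⁻)
open import Data.List.Relation.Unary.AllPairs using (AllPairs; []; _∷_)
open import Data.List.Relation.Unary.Any using (Any; here; there)
open import Data.Maybe using (Maybe; just; nothing)
open import Data.Product using (Σ; ∃₂; _×_; _,_; proj₁; proj₂; uncurry)
open import Data.Sum using (_⊎_; inj₁; inj₂; [_,_]′)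
open import Data.Vec as Vec using (Vec; []; _∷_; lookup; replicate; tabulate; zipWith)
open import Data.Vec.Functional using (insertAt)
open import Data.Vec.Functional.Properties using (insertAt-lookup; insertAt-punchIn)
open import Data.Vec.Properties using (≡-dec; lookup-zipWith; lookup-map; lookup-replicate; lookup∘tabulate)
open import Function using (_∘_; it)
open import Relation.Nullary using (¬_; Dec; yes; no; does; contradiction)
open import Relation.Nullary.Decidable using (¬¬-excluded-middle)
open import Relation.Binary.PropositionalEquality as ≡ using (_≡_; _≢_)

-- The rate 7/8 is the common unit of all savings. Relative to `h`, a factor with an odd share of A
-- loses a factor 3/4 and one with an even share loses nothing, so the mean is (1 + 3/4)/2 = 7/8.
-- The values of `h` also satisfy (4/3)^k ≤ h k / 3, so a rank-one matrix with k live variables has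
-- relative rank at most (3/4)^k, a product over variables in which each has mean 7/8 again. Savings
-- from disjoint blocks of variables therefore simply add up as exponents. The coefficient in front
-- of (7/8)^D must not multiply at product gates, or it would leave the size of the formula behind.
-- This is why only one factor is opened at each product gate: all the others enter with coefficient
-- 1. The lower bound holds over every field because the matrix of 1 + yz over y, z in {0, 1} has
-- rows (1, 1) and (1, 2), whose determinant is 1 in every characteristic. All means are written as
-- sums over subsets with denominators cleared, so the counting stays in the natural numbers.

module SubsetSums where
  open import Data.Nat
  open ℕₚ
  open ≡
  open +-*-Solver using (solve; _:+_; _:*_; _:=_; con)

  -- Sums over all subsets and independence.

  infixl 7 _∩_
  _∩_ : ∀ {n} → Vec Bool n → Vec Bool n → Vec Bool n
  _∩_ = zipWith _∧_

  card : ∀ {n} → Vec Bool n → ℕ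
  card []          = 0
  card (true  ∷ X) = suc (card X)
  card (false ∷ X) = card X

  sumSub : ∀ {n} → (Vec Bool n → ℕ) → ℕ
  sumSub {zero}  G = G []
  sumSub {suc n} G = sumSub (λ A → G (true ∷ A)) + sumSub (λ A → G (false ∷ A))

  sumSub-cong : ∀ {n} {G H : Vec Bool n → ℕ} → (∀ A → G A ≡ H A) → sumSub G ≡ sumSub H
  sumSub-cong {zero}  eq = eq []
  sumSub-cong {suc n} eq = cong₂ _+_ (sumSub-cong (λ A → eq (true ∷ A))) (sumSub-cong (λ A → eq (false ∷ A)))

  sumSub-mono : ∀ {n} {G H : Vec Bool n → ℕ} → (∀ A → G A ≤ H A) → sumSub G ≤ sumSub H
  sumSub-mono {zero}  le = le []
  sumSub-mono {suc n} le = +-mono-≤ (sumSub-mono (λ A → le (true ∷ A))) (sumSub-mono (λ A → le (false ∷ A)))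

  sumSub-+ : ∀ {n} (G H : Vec Bool n → ℕ) → sumSub (λ A → G A + H A) ≡ sumSub G + sumSub H
  sumSub-+ {zero}  G H = refl
  sumSub-+ {suc n} G H = trans
    (cong₂ _+_ (sumSub-+ (λ A → G (true ∷ A)) _) (sumSub-+ (λ A → G (false ∷ A)) _))
    (solve 4 (λ a b c d → a :+ b :+ (c :+ d) := a :+ c :+ (b :+ d)) refl
      (sumSub (λ A → G (true ∷ A))) (sumSub (λ A → H (true ∷ A)))
      (sumSub (λ A → G (false ∷ A))) (sumSub (λ A → H (false ∷ A))))

  sumSub-*ʳ : ∀ {n} (G : Vec Bool n → ℕ) c → sumSub (λ A → G A * c) ≡ sumSub G * c
  sumSub-*ʳ {zero}  G c = refl
  sumSub-*ʳ {suc n} G c = trans (cong₂ _+_ (sumSub-*ʳ (λ A → G (true ∷ A)) c) (sumSub-*ʳ (λ A → G (false ∷ A)) c))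
    (sym (*-distribʳ-+ c (sumSub (λ A → G (true ∷ A))) (sumSub (λ A → G (false ∷ A)))))

  2^suc : ∀ n → 2 ^ suc n ≡ 2 ^ n + 2 ^ n
  2^suc n = cong (2 ^ n +_) (+-identityʳ (2 ^ n))

  sumSub-const : ∀ n c → sumSub {n} (λ _ → c) ≡ 2 ^ n * c
  sumSub-const zero    c = sym (+-identityʳ c)
  sumSub-const (suc n) c = trans (cong₂ _+_ (sumSub-const n c) (sumSub-const n c))
    (trans (sym (*-distribʳ-+ c (2 ^ n) (2 ^ n))) (cong (_* c) (sym (2^suc n))))

  -- An inductive form of "X is the disjoint union of Y and Z", so that independence can be proved
  -- coordinate by coordinate.
  data Split : ∀ {n} → Vec Bool n → Vec Bool n → Vec Bool n → Set where
    []   : Split [] [] []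
    outᵇ : ∀ {n} {X Y Z : Vec Bool n} → Split X Y Z → Split (false ∷ X) (false ∷ Y) (false ∷ Z)
    inˡ  : ∀ {n} {X Y Z : Vec Bool n} → Split X Y Z → Split (true ∷ X) (true ∷ Y) (false ∷ Z)
    inʳ  : ∀ {n} {X Y Z : Vec Bool n} → Split X Y Z → Split (true ∷ X) (false ∷ Y) (true ∷ Z)

  split-∩ : ∀ {n} (X V : Vec Bool n) → Split X (X ∩ V) (X ∩ Vec.map not V)
  split-∩ []          []          = []
  split-∩ (false ∷ X) (v     ∷ V) = outᵇ (split-∩ X V)
  split-∩ (true  ∷ X) (true  ∷ V) = inˡ (split-∩ X V)
  split-∩ (true  ∷ X) (false ∷ V) = inʳ (split-∩ X V)

  split-card : ∀ {n} {X Y Z : Vec Bool n} → Split X Y Z → ∀ A → card (A ∩ X) ≡ card (A ∩ Y) + card (A ∩ Z)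
  split-card []       []          = refl
  split-card (outᵇ s) (false ∷ A) = split-card s A
  split-card (outᵇ s) (true  ∷ A) = split-card s A
  split-card (inˡ s)  (false ∷ A) = split-card s A
  split-card (inˡ s)  (true  ∷ A) = cong suc (split-card s A)
  split-card (inʳ s)  (false ∷ A) = split-card s A
  split-card (inʳ {Y = Y} {Z} s)  (true  ∷ A) = trans (cong suc (split-card s A)) (sym (+-suc (card (A ∩ Y)) _))

  split-cardX : ∀ {n} {X Y Z : Vec Bool n} → Split X Y Z → card X ≡ card Y + card Z
  split-cardX []       = refl
  split-cardX (outᵇ s) = split-cardX s
  split-cardX (inˡ s)  = cong suc (split-cardX s)
  split-cardX (inʳ {Y = Y} s) = trans (cong suc (split-cardX s)) (sym (+-suc (card Y) _))

  split-absorbˡ : ∀ {n} {X Y Z : Vec Bool n} → Split X Y Z → ∀ A → (A ∩ X) ∩ Y ≡ A ∩ Y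
  split-absorbˡ []       []          = refl
  split-absorbˡ (outᵇ s) (false ∷ A) = cong (false ∷_) (split-absorbˡ s A)
  split-absorbˡ (outᵇ s) (true  ∷ A) = cong (false ∷_) (split-absorbˡ s A)
  split-absorbˡ (inˡ s)  (false ∷ A) = cong (false ∷_) (split-absorbˡ s A)
  split-absorbˡ (inˡ s)  (true  ∷ A) = cong (true  ∷_) (split-absorbˡ s A)
  split-absorbˡ (inʳ s)  (false ∷ A) = cong (false ∷_) (split-absorbˡ s A)
  split-absorbˡ (inʳ s)  (true  ∷ A) = cong (false ∷_) (split-absorbˡ s A)

  split-sym : ∀ {n} {X Y Z : Vec Bool n} → Split X Y Z → Split X Z Y
  split-sym []       = []
  split-sym (outᵇ s) = outᵇ (split-sym s)
  split-sym (inˡ s)  = inʳ (split-sym s)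
  split-sym (inʳ s)  = inˡ (split-sym s)

  -- Each coordinate is read by at most one of the two functions, so under a uniform `A` they are
  -- independent and the mean of the product is the product of the means; clearing denominators
  -- leaves one `2 ^ n`.
  sumSub-split : ∀ {n} {X Y Z : Vec Bool n} → Split X Y Z → (G H : Vec Bool n → ℕ) →
    2 ^ n * sumSub (λ A → G (A ∩ Y) * H (A ∩ Z)) ≡ sumSub (λ A → G (A ∩ Y)) * sumSub (λ A → H (A ∩ Z))
  sumSub-split []       G H = +-identityʳ _
  sumSub-split {suc n} {Y = _ ∷ Y} {_ ∷ Z} (outᵇ s) G H = trans
    (solve 2 (λ p a → con 2 :* p :* (a :+ a) := con 4 :* (p :* a)) refl (2 ^ n) _)
    (trans (cong (4 *_) (sumSub-split s (λ A → G (false ∷ A)) (λ A → H (false ∷ A))))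
      (solve 2 (λ a b → con 4 :* (a :* b) := (a :+ a) :* (b :+ b)) refl
        (sumSub (λ A → G (false ∷ A ∩ Y))) (sumSub (λ A → H (false ∷ A ∩ Z)))))
  sumSub-split {suc n} {Y = _ ∷ Y} {_ ∷ Z} (inˡ s) G H = trans
    (solve 3 (λ p a b → con 2 :* p :* (a :+ b) := con 2 :* (p :* a :+ p :* b)) refl (2 ^ n)
       (sumSub (λ A → G (true ∷ A ∩ Y) * H (false ∷ A ∩ Z))) (sumSub (λ A → G (false ∷ A ∩ Y) * H (false ∷ A ∩ Z))))
    (trans (cong (2 *_) (cong₂ _+_ (sumSub-split s (λ A → G (true ∷ A)) (λ A → H (false ∷ A)))
                                   (sumSub-split s (λ A → G (false ∷ A)) (λ A → H (false ∷ A)))))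
      (solve 3 (λ a b c → con 2 :* (a :* c :+ b :* c) := (a :+ b) :* (c :+ c)) refl
        (sumSub (λ A → G (true ∷ A ∩ Y))) (sumSub (λ A → G (false ∷ A ∩ Y))) (sumSub (λ A → H (false ∷ A ∩ Z)))))
  sumSub-split {suc n} {Y = _ ∷ Y} {_ ∷ Z} (inʳ s) G H = trans
    (solve 3 (λ p a b → con 2 :* p :* (a :+ b) := con 2 :* (p :* a :+ p :* b)) refl (2 ^ n)
       (sumSub (λ A → G (false ∷ A ∩ Y) * H (true ∷ A ∩ Z))) (sumSub (λ A → G (false ∷ A ∩ Y) * H (false ∷ A ∩ Z))))
    (trans (cong (2 *_) (cong₂ _+_ (sumSub-split s (λ A → G (false ∷ A)) (λ A → H (true ∷ A)))
                                   (sumSub-split s (λ A → G (false ∷ A)) (λ A → H (false ∷ A)))))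
      (solve 3 (λ a b c → con 2 :* (c :* a :+ c :* b) := (c :+ c) :* (a :+ b)) refl
        (sumSub (λ A → H (true ∷ A ∩ Z))) (sumSub (λ A → H (false ∷ A ∩ Z))) (sumSub (λ A → G (false ∷ A ∩ Y)))))

  -- Parities and the weights that measure relative rank.

  odd : ℕ → Bool
  odd zero    = false
  odd (suc k) = not (odd k)

  -- Toggling one element of `X` flips the parity, so odd and even shares are equally likely.
  sumSub-parity : ∀ {n} (X : Vec Bool n) → 0 < card X → ∀ (G : Bool → ℕ) →
    2 * sumSub (λ A → G (odd (card (A ∩ X)))) ≡ 2 ^ n * (G true + G false)
  sumSub-parity {suc n} (false ∷ X) 0<X G = trans
    (cong (2 *_) (trans (cong (s +_) (sym (+-identityʳ s))) (sumSub-parity X 0<X G)))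
    (sym (*-assoc 2 (2 ^ n) _))
    where s = sumSub (λ A → G (odd (card (A ∩ X))))
  sumSub-parity {suc n} (true ∷ X) 0<X G = begin
    2 * (sumSub (λ A → G (not (odd (card (A ∩ X))))) + sumSub (λ A → G (odd (card (A ∩ X)))))
      ≡⟨ cong (2 *_) (sym (sumSub-+ (λ A → G (not (odd (card (A ∩ X))))) (λ A → G (odd (card (A ∩ X)))))) ⟩
    2 * sumSub (λ A → G (not (odd (card (A ∩ X)))) + G (odd (card (A ∩ X))))
      ≡⟨ cong (2 *_) (sumSub-cong (λ A → both (odd (card (A ∩ X))))) ⟩
    2 * sumSub {n} (λ A → G true + G false) ≡⟨ cong (2 *_) (sumSub-const n _) ⟩
    2 * (2 ^ n * (G true + G false))        ≡⟨ sym (*-assoc 2 (2 ^ n) _) ⟩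
    2 ^ suc n * (G true + G false)          ∎
    where
    open ≡-Reasoning
    both : ∀ b → G (not b) + G b ≡ G true + G false
    both true  = +-comm (G false) (G true)
    both false = refl

  -- Up to the factor 3 this is k ↦ √2^k with √2 replaced by 4/3 at odd k; since (4/3)² ≤ 2
  -- it stays supermultiplicative, while 2^⌊k/2⌋ falls short of it by a factor 3/4 at odd k.
  h : ℕ → ℕ
  h zero          = 3
  h (suc zero)    = 4
  h (suc (suc k)) = 2 * h k

  h-mult : ∀ k l → h k * h l ≤ 3 * h (k + l)
  h-mult zero                l             = ≤-refl
  h-mult (suc zero)          zero          = ≤-refl
  h-mult (suc zero)          (suc zero)    = ≤ᵇ⇒≤ 16 18 _
  h-mult (suc zero)          (suc (suc l)) = begin
    4 * (2 * h l)        ≡⟨ solve 1 (λ a → con 4 :* (con 2 :* a) := con 2 :* (con 4 :* a)) refl (h l) ⟩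
    2 * (4 * h l)        ≤⟨ *-monoʳ-≤ 2 (h-mult 1 l) ⟩
    2 * (3 * h (suc l))  ≡⟨ solve 1 (λ a → con 2 :* (con 3 :* a) := con 3 :* (con 2 :* a)) refl (h (suc l)) ⟩
    3 * (2 * h (suc l))  ∎
    where open ≤-Reasoning
  h-mult (suc (suc k))       l             = begin
    2 * h k * h l        ≡⟨ *-assoc 2 (h k) (h l) ⟩
    2 * (h k * h l)      ≤⟨ *-monoʳ-≤ 2 (h-mult k l) ⟩
    2 * (3 * h (k + l))  ≡⟨ solve 1 (λ a → con 2 :* (con 3 :* a) := con 3 :* (con 2 :* a)) refl (h (k + l)) ⟩
    3 * (2 * h (k + l))  ∎
    where open ≤-Reasoning

  parityWeight : Bool → ℕ
  parityWeight odd? = if odd? then 3 else 4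

  2^half≡ : ∀ k → 2 ^ ⌊ k /2⌋ * 12 ≡ parityWeight (odd k) * h k
  2^half≡ zero          = refl
  2^half≡ (suc zero)    = refl
  2^half≡ (suc (suc k)) with odd k | 2^half≡ k
  ... | true  | eq = trans (*-assoc 2 (2 ^ ⌊ k /2⌋) 12) (trans (cong (2 *_) eq) (solve 1 (λ a → con 2 :* (con 3 :* a) := con 3 :* (con 2 :* a)) refl (h k)))
  ... | false | eq = trans (*-assoc 2 (2 ^ ⌊ k /2⌋) 12) (trans (cong (2 *_) eq) (solve 1 (λ a → con 2 :* (con 4 :* a) := con 4 :* (con 2 :* a)) refl (h k)))

  h≤2^half : ∀ k → h k ≤ 2 ^ ⌊ k /2⌋ * 4
  h≤2^half zero          = ≤ᵇ⇒≤ 3 4 _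
  h≤2^half (suc zero)    = ≤-refl
  h≤2^half (suc (suc k)) = ≤-trans (*-monoʳ-≤ 2 (h≤2^half k)) (≤-reflexive (sym (*-assoc 2 (2 ^ ⌊ k /2⌋) 4)))

  -- Raising `k` by two multiplies the left side by 16 and the right side by 18. In other words,
  -- rank one falls behind h k / 3 by at least a factor 3/4 per live variable.
  4^k≤3^k*h : ∀ k → 3 * 4 ^ k ≤ 3 ^ k * h k
  4^k≤3^k*h zero          = ≤-refl
  4^k≤3^k*h (suc zero)    = ≤-refl
  4^k≤3^k*h (suc (suc k)) = begin
    3 * (4 * (4 * 4 ^ k))      ≡⟨ solve 1 (λ a → con 3 :* (con 4 :* (con 4 :* a)) := con 16 :* (con 3 :* a)) refl (4 ^ k) ⟩
    16 * (3 * 4 ^ k)           ≤⟨ *-mono-≤ (≤ᵇ⇒≤ 16 18 _) (4^k≤3^k*h k) ⟩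
    18 * (3 ^ k * h k)         ≡⟨ solve 2 (λ a b → con 18 :* (a :* b) := con 3 :* (con 3 :* a) :* (con 2 :* b)) refl (3 ^ k) (h k) ⟩
    3 * (3 * 3 ^ k) * (2 * h k) ∎
    where open ≤-Reasoning

  -- Over the denominator `4 ^ card X` this is (3/4)^|B ∩ X|, kept as a product over the elements of
  -- `X` so that its mean can be taken one coordinate at a time.
  pointWeight : ∀ {n} → Vec Bool n → Vec Bool n → ℕ
  pointWeight []          []          = 1
  pointWeight (false ∷ X) (_     ∷ B) = pointWeight X B
  pointWeight (true  ∷ X) (true  ∷ B) = 3 * pointWeight X B
  pointWeight (true  ∷ X) (false ∷ B) = 4 * pointWeight X B

  pointWeight-eq : ∀ {n} (X A : Vec Bool n) →
    4 ^ card (A ∩ X) * pointWeight X (A ∩ X) ≡ 3 ^ card (A ∩ X) * 4 ^ card X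
  pointWeight-eq []          []          = refl
  pointWeight-eq (false ∷ X) (true  ∷ A) = pointWeight-eq X A
  pointWeight-eq (false ∷ X) (false ∷ A) = pointWeight-eq X A
  pointWeight-eq (true  ∷ X) (true  ∷ A) = trans
    (solve 2 (λ a b → con 4 :* a :* (con 3 :* b) := con 12 :* (a :* b)) refl (4 ^ card (A ∩ X)) (pointWeight X (A ∩ X)))
    (trans (cong (12 *_) (pointWeight-eq X A))
      (solve 2 (λ a b → con 12 :* (a :* b) := con 3 :* a :* (con 4 :* b)) refl (3 ^ card (A ∩ X)) (4 ^ card X)))
  pointWeight-eq (true  ∷ X) (false ∷ A) = trans
    (solve 2 (λ a b → a :* (con 4 :* b) := con 4 :* (a :* b)) refl (4 ^ card (A ∩ X)) (pointWeight X (A ∩ X)))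
    (trans (cong (4 *_) (pointWeight-eq X A))
      (solve 2 (λ a b → con 4 :* (a :* b) := a :* (con 4 :* b)) refl (3 ^ card (A ∩ X)) (4 ^ card X)))

  pointWeight-h : ∀ {n} (X A : Vec Bool n) → 3 * 4 ^ card X ≤ pointWeight X (A ∩ X) * h (card (A ∩ X))
  pointWeight-h X A = *-cancelˡ-≤ (3 ^ k * 4 ^ k) {{m*n≢0 (3 ^ k) (4 ^ k) {{m^n≢0 3 k}} {{m^n≢0 4 k}}}} (begin
    3 ^ k * 4 ^ k * (3 * 4 ^ card X)     ≡⟨ solve 3 (λ a b c → a :* b :* (con 3 :* c) := (con 3 :* b) :* (a :* c)) refl (3 ^ k) (4 ^ k) (4 ^ card X) ⟩
    3 * 4 ^ k * (3 ^ k * 4 ^ card X)     ≤⟨ *-monoˡ-≤ (3 ^ k * 4 ^ card X) (4^k≤3^k*h k) ⟩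
    3 ^ k * h k * (3 ^ k * 4 ^ card X)   ≡⟨ cong (3 ^ k * h k *_) (sym (pointWeight-eq X A)) ⟩
    3 ^ k * h k * (4 ^ k * w)            ≡⟨ solve 4 (λ a b c e → a :* b :* (c :* e) := a :* c :* (e :* b)) refl (3 ^ k) (h k) (4 ^ k) w ⟩
    3 ^ k * 4 ^ k * (w * h k)            ∎)
    where
    open ≤-Reasoning
    k = card (A ∩ X)
    w = pointWeight X (A ∩ X)

  -- Each element of `X` contributes (3 + 4)/2 out of 4, the same mean 7/8 as a random parity.
  pointWeight-sum : ∀ {n} (X : Vec Bool n) →
    sumSub (λ A → pointWeight X (A ∩ X)) * 8 ^ card X ≡ 2 ^ n * (7 ^ card X * 4 ^ card X)
  pointWeight-sum [] = refl
  pointWeight-sum {suc n} (false ∷ X) = trans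
    (solve 2 (λ a b → (a :+ a) :* b := con 2 :* (a :* b)) refl (sumSub (λ A → pointWeight X (A ∩ X))) (8 ^ card X))
    (trans (cong (2 *_) (pointWeight-sum X)) (sym (*-assoc 2 (2 ^ n) _)))
  pointWeight-sum {suc n} (true ∷ X) = begin
    (sumSub (λ A → 3 * w A) + sumSub (λ A → 4 * w A)) * (8 * 8 ^ card X)
      ≡⟨ cong (_* (8 * 8 ^ card X)) (cong₂ _+_ (scale 3) (scale 4)) ⟩
    (s * 3 + s * 4) * (8 * 8 ^ card X)
      ≡⟨ solve 2 (λ a b → (a :* con 3 :+ a :* con 4) :* (con 8 :* b) := con 56 :* (a :* b)) refl s (8 ^ card X) ⟩
    56 * (s * 8 ^ card X)
      ≡⟨ cong (56 *_) (pointWeight-sum X) ⟩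
    56 * (2 ^ n * (7 ^ card X * 4 ^ card X))
      ≡⟨ solve 3 (λ a b c → con 56 :* (a :* (b :* c)) := con 2 :* a :* (con 7 :* b :* (con 4 :* c))) refl (2 ^ n) (7 ^ card X) (4 ^ card X) ⟩
    2 ^ suc n * (7 ^ suc (card X) * 4 ^ suc (card X)) ∎
    where
    open ≡-Reasoning
    w : Vec Bool n → ℕ
    w A = pointWeight X (A ∩ X)
    s = sumSub w
    scale : ∀ c → sumSub (λ A → c * w A) ≡ s * c
    scale c = trans (sumSub-cong (λ A → *-comm c (w A))) (sumSub-*ʳ w c)

  half-+ : ∀ {m a b} → a + b ≤ m → a ≤ ⌊ m /2⌋ ⊎ b ≤ ⌊ m /2⌋
  half-+ {m} {a} {b} le with ≤-total a b
  ... | inj₁ a≤b = inj₁ (subst (_≤ ⌊ m /2⌋) (sym (n≡⌊n+n/2⌋ a)) (⌊n/2⌋-mono (≤-trans (+-monoʳ-≤ a a≤b) le)))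
  ... | inj₂ b≤a = inj₂ (subst (_≤ ⌊ m /2⌋) (sym (n≡⌊n+n/2⌋ b)) (⌊n/2⌋-mono (≤-trans (+-monoˡ-≤ b b≤a) le)))

-- Arithmetic of the total saving.

module Exponents where
  open import Data.Nat
  open ℕₚ
  open ≡
  open +-*-Solver using (solve; _:+_; _:*_; _:=_; con)

  -- A game against the formula. At each product gate the opponent divides `n` variables into `t`
  -- parts of at most `n′` each; this saves `t ∸ 1` and leaves the heaviest part to be opened. At
  -- the bottom, `n` variables save at least n/8. The saving `D` is guaranteed if every line of play
  -- reaches it.
  Need : ℕ → ℕ → ℕ → Set
  Need zero    n D = ∀ e → n ≤ 8 * e → D ≤ e
  Need (suc k) n D = ∀ t n′ → n ≤ t * n′ → Need k n′ (D ∸ (t ∸ 1))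

  need-zero : ∀ k n → Need k n 0
  need-zero zero    n e _ = z≤n
  need-zero (suc k) n t n′ _ rewrite 0∸n≡0 (t ∸ 1) = need-zero k n′

  -- The opponent may keep a single part at every gate, saving nothing, and end with e = n at the
  -- bottom.
  need⇒≤ : ∀ k n D → Need k n D → D ≤ n
  need⇒≤ zero    n D need = need n (m≤n*m n 8)
  need⇒≤ (suc k) n D need = need⇒≤ k n D (need 1 n (≤-reflexive (sym (*-identityˡ n))))

  ^-distribʳ-* : ∀ m n k → (m * n) ^ k ≡ m ^ k * n ^ k
  ^-distribʳ-* m n zero    = refl
  ^-distribʳ-* m n (suc k) = trans (cong (m * n *_) (^-distribʳ-* m n k))
    (solve 4 (λ a b u v → a :* b :* (u :* v) := a :* u :* (b :* v)) refl m n (m ^ k) (n ^ k))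

  n<2^n : ∀ n → n < 2 ^ n
  n<2^n zero    = s≤s z≤n
  n<2^n (suc n) = begin-strict
    suc n           ≤⟨ n<2^n n ⟩
    2 ^ n           <⟨ m<m+n (2 ^ n) (m^n>0 2 n) ⟩
    2 ^ n + 2 ^ n   ≡⟨ cong (2 ^ n +_) (sym (+-identityʳ _)) ⟩
    2 ^ suc n       ∎
    where open ≤-Reasoning

  suc≤x2^[n/x] : ∀ x .{{_ : NonZero x}} n → suc n ≤ x * 2 ^ (n / x)
  suc≤x2^[n/x] x n = begin
    suc n                   ≡⟨ cong suc (m≡m%n+[m/n]*n n x) ⟩
    suc (n % x) + n / x * x ≤⟨ +-monoˡ-≤ (n / x * x) (m%n<n n x) ⟩
    suc (n / x) * x         ≡⟨ *-comm (suc (n / x)) x ⟩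
    x * suc (n / x)         ≤⟨ *-monoʳ-≤ x (n<2^n (n / x)) ⟩
    x * 2 ^ (n / x)         ∎
    where open ≤-Reasoning

  -- This takes the place of the AM-GM inequality. By `suc≤x2^[n/x]`, a gate with u + 1 parts
  -- divides `n` by at most x · 2^(u / x): it uses up one factor `x` and u / x of the `c` factors 2,
  -- while it saves u ≥ x · (u / x).
  need-intro : ∀ k x c n D {{_ : NonZero x}} → 8 * (x ^ suc k * 2 ^ c) ≤ n → D ≤ x * c → Need k n D
  need-intro zero x c n D big D≤ e n≤ = begin
    D                ≤⟨ D≤ ⟩
    x * c            ≤⟨ *-monoʳ-≤ x (<⇒≤ (n<2^n c)) ⟩
    x * 2 ^ c        ≡⟨ cong (_* 2 ^ c) (sym (*-identityʳ x)) ⟩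
    x ^ 1 * 2 ^ c    ≤⟨ *-cancelˡ-≤ 8 (≤-trans big n≤) ⟩
    e                ∎
    where open ≤-Reasoning
  need-intro (suc k) x c n D big D≤ zero n′ n≤ =
    contradiction (≤-trans big n≤)
      (<⇒≱ (*-mono-< {0} {8} {0} (s≤s z≤n) (*-mono-< {0} {x ^ suc (suc k)} {0} (m^n>0 x (suc (suc k))) (m^n>0 2 c))))
  need-intro (suc k) x c n D big D≤ (suc u) n′ n≤ with u / x ≤? c
  -- So many parts save all of `D` at this one gate.
  ... | no ¬q = subst (Need k n′) (sym (m≤n⇒m∸n≡0 D≤u)) (need-zero k n′)
    where
    open ≤-Reasoning
    D≤u : D ≤ u
    D≤u = begin
      D            ≤⟨ D≤ ⟩
      x * c        ≤⟨ *-monoʳ-≤ x (<⇒≤ (≰⇒> ¬q)) ⟩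
      x * (u / x)  ≡⟨ *-comm x (u / x) ⟩
      u / x * x    ≤⟨ m/n*n≤m u x ⟩
      u            ∎
  ... | yes q = need-intro k x (c ∸ u / x) n′ (D ∸ u) big′ D≤′
    where
    open ≤-Reasoning
    p = u / x
    big′ : 8 * (x ^ suc k * 2 ^ (c ∸ p)) ≤ n′
    big′ = *-cancelˡ-≤ (x * 2 ^ p) {{m*n≢0 x (2 ^ p) {{it}} {{m^n≢0 2 p}}}} (begin
      x * 2 ^ p * (8 * (x ^ suc k * 2 ^ (c ∸ p)))
        ≡⟨ solve 4 (λ a b y z → a :* b :* (con 8 :* (y :* z)) := con 8 :* (a :* y :* (b :* z))) refl x (2 ^ p) (x ^ suc k) (2 ^ (c ∸ p)) ⟩
      8 * (x ^ suc (suc k) * (2 ^ p * 2 ^ (c ∸ p)))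
        ≡⟨ cong (λ z → 8 * (x ^ suc (suc k) * z)) (sym (^-distribˡ-+-* 2 p (c ∸ p))) ⟩
      8 * (x ^ suc (suc k) * 2 ^ (p + (c ∸ p)))
        ≡⟨ cong (λ z → 8 * (x ^ suc (suc k) * 2 ^ z)) (m+[n∸m]≡n q) ⟩
      8 * (x ^ suc (suc k) * 2 ^ c)   ≤⟨ big ⟩
      n                               ≤⟨ n≤ ⟩
      suc u * n′                      ≤⟨ *-monoˡ-≤ n′ (suc≤x2^[n/x] x u) ⟩
      x * 2 ^ p * n′                  ∎)
    D≤′ : D ∸ u ≤ x * (c ∸ p)
    D≤′ = begin
      D ∸ u             ≤⟨ ∸-mono D≤ (≤-trans (≤-reflexive (*-comm x p)) (m/n*n≤m u x)) ⟩
      x * c ∸ x * p     ≡⟨ sym (*-distribˡ-∸ x c p) ⟩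
      x * (c ∸ p)       ∎

  -- 3·8^D ≤ 4·S·7^D is raised to the sixth power, where (8/7)^6 ≥ 2 and (4/3)^6 ≤ 6.
  pow-bound : ∀ D S → 3 * 8 ^ D ≤ 4 * (S * 7 ^ D) → 2 ^ D ≤ 6 * S ^ 6
  pow-bound D S le = *-cancelˡ-≤ 729 (*-cancelʳ-≤ _ _ ((7 ^ D) ^ 6) {{m^n≢0 (7 ^ D) 6 {{m^n≢0 7 D}}}} (begin
      729 * 2 ^ D * (7 ^ D) ^ 6        ≡⟨ cong (729 * 2 ^ D *_) (swap 7) ⟩
      729 * 2 ^ D * (7 ^ 6) ^ D        ≡⟨ *-assoc 729 (2 ^ D) _ ⟩
      729 * (2 ^ D * (7 ^ 6) ^ D)      ≡⟨ cong (729 *_) (sym (^-distribʳ-* 2 (7 ^ 6) D)) ⟩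
      729 * (2 * 7 ^ 6) ^ D            ≤⟨ *-monoʳ-≤ 729 (^-monoˡ-≤ D (≤ᵇ⇒≤ (2 * 7 ^ 6) (8 ^ 6) _)) ⟩
      729 * (8 ^ 6) ^ D                ≡⟨ cong (729 *_) (sym (swap 8)) ⟩
      3 ^ 6 * (8 ^ D) ^ 6              ≡⟨ sym (^-distribʳ-* 3 (8 ^ D) 6) ⟩
      (3 * 8 ^ D) ^ 6                  ≤⟨ ^-monoˡ-≤ 6 le ⟩
      (4 * (S * 7 ^ D)) ^ 6            ≡⟨ ^-distribʳ-* 4 (S * 7 ^ D) 6 ⟩
      4096 * (S * 7 ^ D) ^ 6           ≡⟨ cong (4096 *_) (^-distribʳ-* S (7 ^ D) 6) ⟩
      4096 * (S ^ 6 * (7 ^ D) ^ 6)     ≤⟨ *-monoˡ-≤ (S ^ 6 * (7 ^ D) ^ 6) (≤ᵇ⇒≤ 4096 (729 * 6) _) ⟩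
      729 * 6 * (S ^ 6 * (7 ^ D) ^ 6)  ≡⟨ sym (*-assoc (729 * 6) (S ^ 6) _) ⟩
      729 * 6 * S ^ 6 * (7 ^ D) ^ 6    ≡⟨ cong (_* (7 ^ D) ^ 6) (*-assoc 729 6 (S ^ 6)) ⟩
      729 * (6 * S ^ 6) * (7 ^ D) ^ 6  ∎))
    where
    open ≤-Reasoning
    swap : ∀ m → (m ^ D) ^ 6 ≡ (m ^ 6) ^ D
    swap m = trans (^-*-assoc m D 6) (trans (cong (m ^_) (*-comm D 6)) (sym (^-*-assoc m 6 D)))

  size≥2 : ∀ S → 2 ^ 3 ≤ 6 * S ^ 6 → 2 ≤ S
  size≥2 zero          ()
  size≥2 (suc zero)    (s≤s (s≤s (s≤s (s≤s (s≤s (s≤s ()))))))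
  size≥2 (suc (suc S)) _ = s≤s (s≤s z≤n)

  6S^6≤S^9 : ∀ {S} → 2 ≤ S → 6 * S ^ 6 ≤ S ^ 9
  6S^6≤S^9 {S} 2≤S = begin
    6 * S ^ 6      ≤⟨ *-monoˡ-≤ (S ^ 6) (≤-trans (≤ᵇ⇒≤ 6 (2 ^ 3) _) (^-monoˡ-≤ 3 2≤S)) ⟩
    S ^ 3 * S ^ 6  ≡⟨ sym (^-distribˡ-+-* S 3 6) ⟩
    S ^ 9          ∎
    where open ≤-Reasoning

  module _ (d k r s : ℕ) (64≤d : 64 ≤ d) (2^Δ≤d : 2 ^ suc k ≤ d) (0<s : 0 < s) (r^Δ≤ : r ^ suc k ≤ d * s ^ suc k) where
    open ≤-Reasoning
    private
      Δ = suc k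
      instance
        s≢0 : NonZero s
        s≢0 = >-nonZero 0<s

    -- The fraction r / s approximates d^(1/Δ) from below, and `D` has to be of order Δ r / s. Once
    -- r / s is at least 16, `need-intro` with x near r / (16 s) and c = Δ achieves this; for
    -- smaller r / s a saving of order Δ is enough.
    large-exponent : Σ ℕ λ D → Need k d D × Δ * r ≤ 32 * s * D
    large-exponent with r <? 16 * s
    large-exponent | yes r<16s with Δ ≤? 6
    -- The choice x = 1, c = 3 asks for 8 · 2^3 ≤ d, the origin of the threshold 64.
    ... | yes Δ≤6 = 3 , need-intro k 1 3 d 3 (subst (λ z → 8 * (z * 8) ≤ d) (sym (^-zeroˡ Δ)) 64≤d) ≤-refl ,
      (begin
        Δ * r             ≤⟨ *-mono-≤ Δ≤6 (<⇒≤ r<16s) ⟩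
        6 * (16 * s)      ≡⟨ solve 1 (λ z → con 6 :* (con 16 :* z) := con 32 :* z :* con 3) refl s ⟩
        32 * s * 3        ∎)
    -- Three of the Δ twos in 2^Δ ≤ d pay for the constant 8 of `need-intro`, and Δ - 3 is still at
    -- least Δ / 2.
    ... | no Δ≰6 = c , need-intro k 1 c d c big (≤-reflexive (sym (*-identityˡ c))) ,
      (begin
        Δ * r               ≤⟨ *-monoʳ-≤ Δ (<⇒≤ r<16s) ⟩
        Δ * (16 * s)        ≤⟨ *-monoˡ-≤ (16 * s) Δ≤2c ⟩
        (c + c) * (16 * s)  ≡⟨ solve 2 (λ y z → (y :+ y) :* (con 16 :* z) := con 32 :* z :* y) refl c s ⟩
        32 * s * c          ∎)
      where
      c = Δ ∸ 3
      3≤Δ : 3 + c ≡ Δ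
      3≤Δ = m+[n∸m]≡n (≤-trans (≤ᵇ⇒≤ 3 6 _) (<⇒≤ (≰⇒> Δ≰6)))
      3≤c : 3 ≤ c
      3≤c = ∸-monoˡ-≤ 3 (<⇒≤ (≰⇒> Δ≰6))
      Δ≤2c : Δ ≤ c + c
      Δ≤2c = subst (_≤ c + c) 3≤Δ (+-monoˡ-≤ c 3≤c)
      big : 8 * (1 ^ Δ * 2 ^ c) ≤ d
      big = begin
        8 * (1 ^ Δ * 2 ^ c)  ≡⟨ cong (λ z → 8 * (z * 2 ^ c)) (^-zeroˡ Δ) ⟩
        8 * (1 * 2 ^ c)      ≡⟨ cong (8 *_) (*-identityˡ (2 ^ c)) ⟩
        2 ^ 3 * 2 ^ c        ≡⟨ sym (^-distribˡ-+-* 2 3 c) ⟩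
        2 ^ (3 + c)          ≡⟨ cong (2 ^_) 3≤Δ ⟩
        2 ^ Δ                ≤⟨ 2^Δ≤d ⟩
        d                    ∎
    -- Here 16 is 8 · 2: the 8 absorbs the constant of `need-intro`, as 8 ≤ 8^Δ, and the 2 absorbs
    -- 2^c with c = Δ.
    large-exponent | no r≮16s = q * Δ , need-intro k q Δ d (q * Δ) big ≤-refl ,
      (begin
        Δ * r                            ≤⟨ *-monoʳ-≤ Δ r≤ ⟩
        Δ * (q * (16 * s) + q * (16 * s)) ≡⟨ solve 3 (λ t y z → t :* (y :* (con 16 :* z) :+ y :* (con 16 :* z)) := con 32 :* z :* (y :* t)) refl Δ q s ⟩
        32 * s * (q * Δ)                 ∎)
      where
      instance
        16s≢0 : NonZero (16 * s)
        16s≢0 = m*n≢0 16 s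
      q = r / (16 * s)
      0<q : 0 < q
      0<q = m≥n⇒m/n>0 (≮⇒≥ r≮16s)
      instance
        q≢0 : NonZero q
        q≢0 = >-nonZero 0<q
      r≤ : r ≤ q * (16 * s) + q * (16 * s)
      r≤ = begin
        r                               ≡⟨ m≡m%n+[m/n]*n r (16 * s) ⟩
        r % (16 * s) + q * (16 * s)     ≤⟨ +-monoˡ-≤ _ (<⇒≤ (m%n<n r (16 * s))) ⟩
        16 * s + q * (16 * s)           ≤⟨ +-monoˡ-≤ _ (m≤n*m (16 * s) q) ⟩
        q * (16 * s) + q * (16 * s)     ∎
      big : 8 * (q ^ Δ * 2 ^ Δ) ≤ d
      big = *-cancelʳ-≤ _ _ (s ^ Δ) {{m^n≢0 s Δ}} (begin
        8 * (q ^ Δ * 2 ^ Δ) * s ^ Δ       ≤⟨ *-monoˡ-≤ (s ^ Δ) (*-monoˡ-≤ (q ^ Δ * 2 ^ Δ) (m≤m*n 8 (8 ^ k) {{m^n≢0 8 k}})) ⟩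
        8 ^ Δ * (q ^ Δ * 2 ^ Δ) * s ^ Δ   ≡⟨ cong (λ z → 8 ^ Δ * z * s ^ Δ) (sym (^-distribʳ-* q 2 Δ)) ⟩
        8 ^ Δ * (q * 2) ^ Δ * s ^ Δ       ≡⟨ cong (_* s ^ Δ) (sym (^-distribʳ-* 8 (q * 2) Δ)) ⟩
        (8 * (q * 2)) ^ Δ * s ^ Δ         ≡⟨ sym (^-distribʳ-* (8 * (q * 2)) s Δ) ⟩
        (8 * (q * 2) * s) ^ Δ             ≡⟨ cong (_^ Δ) (solve 2 (λ y z → con 8 :* (y :* con 2) :* z := y :* (con 16 :* z)) refl q s) ⟩
        (q * (16 * s)) ^ Δ                ≤⟨ ^-monoˡ-≤ Δ (m/n*n≤m r (16 * s)) ⟩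
        r ^ Δ                             ≤⟨ r^Δ≤ ⟩
        d * s ^ Δ                         ∎)

open SubsetSums
open Exponents

-- From equal coefficients to equal values.

module Evaluation {a ℓ : Level} (F : Field a ℓ) where
  open Field F hiding (zero)
  open import Relation.Binary.Reasoning.Setoid setoid
  open import Algebra.Properties.Semiring.Exp semiring using (_^_; ^-homo-*)
  open import Algebra.Solver.Ring.NaturalCoefficients.Default commutativeSemiring using (solve; _:+_; _:*_; _:=_; con)

  mutual
    eval : ∀ {n} → Formula F n → (Fin n → Carrier) → Carrier
    eval (var i)    σ = σ i
    eval (const c)  σ = c
    eval (sumG gs)  σ = evalSum gs σ
    eval (prodG gs) σ = evalProd gs σ

    evalSum : ∀ {n} → List (Formula F n) → (Fin n → Carrier) → Carrier
    evalSum []       σ = 0#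
    evalSum (g ∷ gs) σ = eval g σ + evalSum gs σ

    evalProd : ∀ {n} → List (Formula F n) → (Fin n → Carrier) → Carrier
    evalProd []       σ = 1#
    evalProd (g ∷ gs) σ = eval g σ * evalProd gs σ

  sumTo : ℕ → (ℕ → Carrier) → Carrier
  sumTo zero    f = 0#
  sumTo (suc n) f = f 0 + sumTo n (f ∘ suc)

  sumTo-cong : ∀ n {f g} → (∀ j → j ℕ.< n → f j ≈ g j) → sumTo n f ≈ sumTo n g
  sumTo-cong zero    eq = refl
  sumTo-cong (suc n) eq = +-cong (eq 0 (s≤s z≤n)) (sumTo-cong n (λ j j<n → eq (suc j) (s≤s j<n)))

  sumTo-+ : ∀ n f g → sumTo n (λ j → f j + g j) ≈ sumTo n f + sumTo n g
  sumTo-+ zero    f g = sym (+-identityˡ 0#)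
  sumTo-+ (suc n) f g = trans (+-congˡ (sumTo-+ n (f ∘ suc) (g ∘ suc)))
    (solve 4 (λ x y u v → x :+ y :+ (u :+ v) := x :+ u :+ (y :+ v)) refl (f 0) (g 0) _ _)

  sumTo-*ˡ : ∀ n c f → sumTo n (λ j → c * f j) ≈ c * sumTo n f
  sumTo-*ˡ zero    c f = sym (zeroʳ c)
  sumTo-*ˡ (suc n) c f = trans (+-congˡ (sumTo-*ˡ n c (f ∘ suc))) (sym (distribˡ c _ _))

  sumTo-*ʳ : ∀ n c f → sumTo n (λ j → f j * c) ≈ sumTo n f * c
  sumTo-*ʳ zero    c f = sym (zeroˡ c)
  sumTo-*ʳ (suc n) c f = trans (+-congˡ (sumTo-*ʳ n c (f ∘ suc))) (sym (distribʳ c _ _))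

  sumTo-zero : ∀ n {f} → (∀ j → f j ≈ 0#) → sumTo n f ≈ 0#
  sumTo-zero zero    z = refl
  sumTo-zero (suc n) z = trans (+-cong (z 0) (sumTo-zero n (z ∘ suc))) (+-identityˡ 0#)

  sumTo-extend : ∀ n k f → (∀ j → n ℕ.≤ j → f j ≈ 0#) → sumTo (n ℕ.+ k) f ≈ sumTo n f
  sumTo-extend zero    k f z = sumTo-zero k (λ j → z j z≤n)
  sumTo-extend (suc n) k f z = +-congˡ (sumTo-extend n k (f ∘ suc) (λ j n≤j → z (suc j) (s≤s n≤j)))

  sumTo-stable : ∀ n {p q} f → (∀ j → n ℕ.≤ j → f j ≈ 0#) → n ℕ.≤ p → n ℕ.≤ q → sumTo p f ≈ sumTo q f
  sumTo-stable n {p} {q} f z n≤p n≤q = begin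
    sumTo p f                 ≡⟨ ≡.cong (λ k → sumTo k f) (≡.sym (ℕₚ.m+[n∸m]≡n n≤p)) ⟩
    sumTo (n ℕ.+ (p ∸ n)) f   ≈⟨ sumTo-extend n (p ∸ n) f z ⟩
    sumTo n f                 ≈⟨ sym (sumTo-extend n (q ∸ n) f z) ⟩
    sumTo (n ℕ.+ (q ∸ n)) f   ≡⟨ ≡.cong (λ k → sumTo k f) (ℕₚ.m+[n∸m]≡n n≤q) ⟩
    sumTo q f                 ∎

  sumTo-single : ∀ n e f → e ℕ.< n → (∀ j → j ≢ e → f j ≈ 0#) → sumTo n f ≈ f e
  sumTo-single (suc n) zero    f _         z = trans (+-congˡ (sumTo-zero n (λ j → z (suc j) (λ ())))) (+-identityʳ _)
  sumTo-single (suc n) (suc e) f (s≤s e<n) z = trans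
    (+-cong (z 0 (λ ())) (sumTo-single n e (f ∘ suc) e<n (λ j j≢e → z (suc j) (j≢e ∘ ℕₚ.suc-injective))))
    (+-identityˡ _)

  -- Both sides are the sum of α e · β f over e + f ≤ D; the induction splits off e = 0.
  cauchy-product : ∀ D (α β : ℕ → Carrier) →
    sumTo (suc D) (λ x → sumTo (suc x) (λ e → α e * β (x ∸ e))) ≈
    sumTo (suc D) (λ e → α e * sumTo (suc (D ∸ e)) β)
  cauchy-product zero    α β = solve 2 (λ x y → x :* y :+ con 0 :+ con 0 := x :* (y :+ con 0) :+ con 0) refl (α 0) (β 0)
  cauchy-product (suc D) α β = begin
    (α 0 * β 0 + 0#) + sumTo (suc D) (λ x → α 0 * β (suc x) + inner x)
      ≈⟨ +-congˡ (sumTo-+ (suc D) (λ x → α 0 * β (suc x)) inner) ⟩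
    (α 0 * β 0 + 0#) + (sumTo (suc D) (λ x → α 0 * β (suc x)) + sumTo (suc D) inner)
      ≈⟨ +-cong (+-identityʳ _) (+-cong (sumTo-*ˡ (suc D) (α 0) (β ∘ suc)) (cauchy-product D (α ∘ suc) β)) ⟩
    α 0 * β 0 + (α 0 * sumTo (suc D) (β ∘ suc) + rest)
      ≈⟨ solve 4 (λ u x y z → u :* x :+ (u :* y :+ z) := u :* (x :+ y) :+ z) refl (α 0) (β 0) _ rest ⟩
    α 0 * sumTo (suc (suc D)) β + rest ∎
    where
    inner : ℕ → Carrier
    inner x = sumTo (suc x) (λ e → α (suc e) * β (x ∸ e))
    rest = sumTo (suc D) (λ e → α (suc e) * sumTo (suc (D ∸ e)) β)

  -- The truncation of Σ_m c(m)·σ^m to exponents at most D in every variable.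
  evalCoeffs : ∀ {n} → ℕ → (Fin n → Carrier) → (Vec ℕ n → Carrier) → Carrier
  evalCoeffs {zero}  D σ c = c []
  evalCoeffs {suc n} D σ c = sumTo (suc D) (λ e → σ zero ^ e * evalCoeffs D (σ ∘ suc) (λ m → c (e ∷ m)))

  evalCoeffs-cong : ∀ {n} D σ {c c′ : Vec ℕ n → Carrier} → (∀ m → c m ≈ c′ m) → evalCoeffs D σ c ≈ evalCoeffs D σ c′
  evalCoeffs-cong {zero}  D σ eq = eq []
  evalCoeffs-cong {suc n} D σ eq =
    sumTo-cong (suc D) (λ e _ → *-congˡ {σ zero ^ e} (evalCoeffs-cong D (σ ∘ suc) (λ m → eq (e ∷ m))))

  evalCoeffs-+ : ∀ {n} D σ (c c′ : Vec ℕ n → Carrier) →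
    evalCoeffs D σ (λ m → c m + c′ m) ≈ evalCoeffs D σ c + evalCoeffs D σ c′
  evalCoeffs-+ {zero}  D σ c c′ = refl
  evalCoeffs-+ {suc n} D σ c c′ = trans
    (sumTo-cong (suc D) (λ e _ → trans (*-congˡ (evalCoeffs-+ D (σ ∘ suc) (λ m → c (e ∷ m)) (λ m → c′ (e ∷ m)))) (distribˡ (σ zero ^ e) _ _)))
    (sumTo-+ (suc D) (λ e → σ zero ^ e * evalCoeffs D (σ ∘ suc) (λ m → c (e ∷ m)))
                     (λ e → σ zero ^ e * evalCoeffs D (σ ∘ suc) (λ m → c′ (e ∷ m))))

  evalCoeffs-0 : ∀ {n} D σ {c : Vec ℕ n → Carrier} → (∀ m → c m ≈ 0#) → evalCoeffs D σ c ≈ 0#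
  evalCoeffs-0 {zero}  D σ z = z []
  evalCoeffs-0 {suc n} D σ z = sumTo-zero (suc D) (λ e →
    trans (*-congˡ (evalCoeffs-0 D (σ ∘ suc) (λ m → z (e ∷ m)))) (zeroʳ (σ zero ^ e)))

  evalCoeffs-* : ∀ {n} D σ k (c : Vec ℕ n → Carrier) → evalCoeffs D σ (λ m → k * c m) ≈ k * evalCoeffs D σ c
  evalCoeffs-* {zero}  D σ k c = refl
  evalCoeffs-* {suc n} D σ k c = trans
    (sumTo-cong (suc D) (λ e _ → trans (*-congˡ (evalCoeffs-* D (σ ∘ suc) k (λ m → c (e ∷ m))))
      (solve 3 (λ x y z → x :* (y :* z) := y :* (x :* z)) refl (σ zero ^ e) k _)))
    (sumTo-*ˡ (suc D) k (λ e → σ zero ^ e * evalCoeffs D (σ ∘ suc) (λ m → c (e ∷ m))))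

  evalCoeffs-sumTo : ∀ {n} D σ k (c : ℕ → Vec ℕ n → Carrier) →
    evalCoeffs D σ (λ m → sumTo k (λ j → c j m)) ≈ sumTo k (λ j → evalCoeffs D σ (c j))
  evalCoeffs-sumTo D σ zero    c = evalCoeffs-0 D σ (λ _ → refl)
  evalCoeffs-sumTo D σ (suc k) c = trans (evalCoeffs-+ D σ (c 0) _) (+-congˡ (evalCoeffs-sumTo D σ k (c ∘ suc)))

  sumF-++ : ∀ {A : Set} (φ : A → Carrier) xs ys →
    sumF F (List.map φ (xs ++ ys)) ≈ sumF F (List.map φ xs) + sumF F (List.map φ ys)
  sumF-++ φ []       ys = sym (+-identityˡ _)
  sumF-++ φ (x ∷ xs) ys = trans (+-congˡ (sumF-++ φ xs ys)) (sym (+-assoc _ _ _))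

  sumF-0 : ∀ {A : Set} (φ : A → Carrier) xs → (∀ x → φ x ≈ 0#) → sumF F (List.map φ xs) ≈ 0#
  sumF-0 φ []       z = refl
  sumF-0 φ (x ∷ xs) z = trans (+-cong (z x) (sumF-0 φ xs z)) (+-identityˡ 0#)

  conv : ∀ {n} → (Vec ℕ n → Carrier) → (Vec ℕ n → Carrier) → Vec ℕ n → Carrier
  conv c c′ m = sumF F (List.map (λ m₁ → c m₁ * c′ (zipWith _∸_ m m₁)) (below F m))

  sumF-concatMap : ∀ {n} (φ : Vec ℕ (suc n) → Carrier) L (g : ℕ → ℕ) k →
    sumF F (List.map φ (concatMap (λ e → List.map (e ∷_) L) (applyUpTo g k))) ≈
    sumTo k (λ j → sumF F (List.map (λ m → φ (g j ∷ m)) L))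
  sumF-concatMap φ L g zero    = refl
  sumF-concatMap φ L g (suc k) = trans
    (sumF-++ φ (List.map (g 0 ∷_) L) _)
    (+-cong (reflexive (≡.cong (sumF F) (≡.sym (map-∘ L)))) (sumF-concatMap φ L (g ∘ suc) k))

  conv-cons : ∀ {n} (c c′ : Vec ℕ (suc n) → Carrier) x (xs : Vec ℕ n) →
    conv c c′ (x ∷ xs) ≈ sumTo (suc x) (λ e → conv (λ m → c (e ∷ m)) (λ m → c′ ((x ∸ e) ∷ m)) xs)
  conv-cons c c′ x xs = sumF-concatMap (λ m₁ → c m₁ * c′ (zipWith _∸_ (x ∷ xs) m₁)) (below F xs) (λ e → e) (suc x)

  -- Each exponent is bounded separately, not the total degree, to match the truncation variable by
  -- variable in `evalCoeffs`.
  DegreeBound : ∀ {n} → ℕ → (Vec ℕ n → Carrier) → Set ℓ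
  DegreeBound D c = ∀ m i → D ℕ.< lookup m i → c m ≈ 0#

  degree-conv : ∀ {n D D′} {c c′ : Vec ℕ n → Carrier} →
    DegreeBound D c → DegreeBound D′ c′ → DegreeBound (D ℕ.+ D′) (conv c c′)
  degree-conv {D = D} {D′} {c} {c′} b b′ m i lt = sumF-0 _ (below F m) term
    where
    term : ∀ m₁ → c m₁ * c′ (zipWith _∸_ m m₁) ≈ 0#
    term m₁ with D ℕ.<? lookup m₁ i
    ... | yes D< = trans (*-congʳ (b m₁ i D<)) (zeroˡ _)
    ... | no  D≮ = trans (*-congˡ (b′ _ i D′<)) (zeroʳ _)
      where
      D′< : D′ ℕ.< lookup (zipWith _∸_ m m₁) i
      D′< = ≡.subst (D′ ℕ.<_) (≡.sym (lookup-zipWith _∸_ i m m₁))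
        (ℕₚ.m+n≤o⇒m≤o∸n (suc D′) (ℕₚ.≤-trans (ℕₚ.+-monoʳ-≤ (suc D′) (ℕₚ.≮⇒≥ D≮))
          (ℕₚ.≤-trans (ℕₚ.≤-reflexive (≡.cong suc (ℕₚ.+-comm D′ D))) lt)))

  -- Evaluation is multiplicative on polynomials but not on their truncations: the cut at `D` has to
  -- lie above the sum of the degrees, so that no term of the product is lost.
  evalCoeffs-conv : ∀ {n D D₁ D₂} σ {c c′ : Vec ℕ n → Carrier} →
    DegreeBound D₁ c → DegreeBound D₂ c′ → D₁ ℕ.+ D₂ ℕ.≤ D →
    evalCoeffs D σ (conv c c′) ≈ evalCoeffs D σ c * evalCoeffs D σ c′
  evalCoeffs-conv {zero}  σ b b′ le = +-identityʳ _
  evalCoeffs-conv {suc n} {D} {D₁} {D₂} σ {c} {c′} b b′ le = begin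
    sumTo (suc D) (λ x → σ zero ^ x * E (λ m → conv c c′ (x ∷ m)))
      ≈⟨ sumTo-cong (suc D) (λ x _ → step x) ⟩
    sumTo (suc D) (λ x → sumTo (suc x) (λ e → α e * β (x ∸ e)))
      ≈⟨ cauchy-product D α β ⟩
    sumTo (suc D) (λ e → α e * sumTo (suc (D ∸ e)) β)
      ≈⟨ sumTo-cong (suc D) (λ e _ → full e) ⟩
    sumTo (suc D) (λ e → α e * sumTo (suc D) β)
      ≈⟨ sumTo-*ʳ (suc D) _ α ⟩
    sumTo (suc D) α * sumTo (suc D) β ∎
    where
    E : (Vec ℕ n → Carrier) → Carrier
    E = evalCoeffs D (σ ∘ suc)
    α β : ℕ → Carrier
    α e = σ zero ^ e * E (λ m → c (e ∷ m))
    β e = σ zero ^ e * E (λ m → c′ (e ∷ m))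
    step : ∀ x → σ zero ^ x * E (λ m → conv c c′ (x ∷ m)) ≈ sumTo (suc x) (λ e → α e * β (x ∸ e))
    step x = begin
      σ zero ^ x * E (λ m → conv c c′ (x ∷ m))
        ≈⟨ *-congˡ (evalCoeffs-cong D (σ ∘ suc) (conv-cons c c′ x)) ⟩
      σ zero ^ x * E (λ m → sumTo (suc x) (λ e → conv (λ m → c (e ∷ m)) (λ m → c′ ((x ∸ e) ∷ m)) m))
        ≈⟨ *-congˡ (evalCoeffs-sumTo D (σ ∘ suc) (suc x) (λ e → conv (λ m → c (e ∷ m)) (λ m → c′ ((x ∸ e) ∷ m)))) ⟩
      σ zero ^ x * sumTo (suc x) (λ e → E (conv (λ m → c (e ∷ m)) (λ m → c′ ((x ∸ e) ∷ m))))
        ≈⟨ sym (sumTo-*ˡ (suc x) (σ zero ^ x) (λ e → E (conv (λ m → c (e ∷ m)) (λ m → c′ ((x ∸ e) ∷ m))))) ⟩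
      sumTo (suc x) (λ e → σ zero ^ x * E (conv (λ m → c (e ∷ m)) (λ m → c′ ((x ∸ e) ∷ m))))
        ≈⟨ sumTo-cong (suc x) (λ e e<x → trans
             (*-cong (trans (reflexive (≡.cong (σ zero ^_) (≡.sym (ℕₚ.m+[n∸m]≡n (ℕₚ.≤-pred e<x))))) (^-homo-* (σ zero) e (x ∸ e)))
                     (evalCoeffs-conv (σ ∘ suc) (λ m i → b (e ∷ m) (suc i)) (λ m i → b′ ((x ∸ e) ∷ m) (suc i)) le))
             (solve 4 (λ p q u v → p :* q :* (u :* v) := p :* u :* (q :* v)) refl (σ zero ^ e) (σ zero ^ (x ∸ e)) _ _)) ⟩
      sumTo (suc x) (λ e → α e * β (x ∸ e)) ∎
    -- For e beyond `D₁` the term vanishes; otherwise D ∸ e ≥ D₂, so the shorter sum already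
    -- contains every non-zero β.
    full : ∀ e → α e * sumTo (suc (D ∸ e)) β ≈ α e * sumTo (suc D) β
    full e with D₁ ℕ.<? e
    ... | yes D₁<e = trans (zero-left _) (sym (zero-left _))
      where
      zero-left : ∀ z → α e * z ≈ 0#
      zero-left z = trans (*-congʳ (trans (*-congˡ (evalCoeffs-0 D (σ ∘ suc) (λ m → b (e ∷ m) zero D₁<e))) (zeroʳ (σ zero ^ e)))) (zeroˡ z)
    ... | no D₁≮e = *-congˡ (sumTo-stable (suc D₂) β
        (λ j D₂<j → trans (*-congˡ (evalCoeffs-0 D (σ ∘ suc) (λ m → b′ (j ∷ m) zero D₂<j))) (zeroʳ (σ zero ^ j)))
        (s≤s (ℕₚ.m+n≤o⇒m≤o∸n D₂ (ℕₚ.≤-trans (ℕₚ.+-monoʳ-≤ D₂ (ℕₚ.≮⇒≥ D₁≮e)) (ℕₚ.≤-trans (ℕₚ.≤-reflexive (ℕₚ.+-comm D₂ D₁)) le))))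
        (s≤s (ℕₚ.≤-trans (ℕₚ.m≤n+m D₂ D₁) le)))

  monCoeff-≢ : ∀ {n} {e m : Vec ℕ n} → m ≢ e → monCoeff F e m ≈ 0#
  monCoeff-≢ {e = e} {m} m≢e with ≡-dec ℕ._≟_ m e
  ... | yes m≡e = contradiction m≡e m≢e
  ... | no _    = refl

  monCoeff-refl : ∀ {n} (e : Vec ℕ n) → monCoeff F e e ≈ 1#
  monCoeff-refl e with ≡-dec ℕ._≟_ e e
  ... | yes _  = refl
  ... | no e≢e = contradiction ≡.refl e≢e

  monCoeff-cons : ∀ {n} x (e m : Vec ℕ n) → monCoeff F (x ∷ e) (x ∷ m) ≈ monCoeff F e m
  monCoeff-cons x e m = go (≡-dec ℕ._≟_ m e)
    where
    go : Dec (m ≡ e) → monCoeff F (x ∷ e) (x ∷ m) ≈ monCoeff F e m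
    go (yes ≡.refl) = trans (monCoeff-refl (x ∷ m)) (sym (monCoeff-refl m))
    go (no m≢e)     = trans (monCoeff-≢ {e = x ∷ e} {m = x ∷ m} (λ { ≡.refl → m≢e ≡.refl })) (sym (monCoeff-≢ {e = e} {m} m≢e))

  evalMon : ∀ {n} → (Fin n → Carrier) → Vec ℕ n → Carrier
  evalMon σ []      = 1#
  evalMon σ (x ∷ e) = σ zero ^ x * evalMon (σ ∘ suc) e

  evalCoeffs-mon : ∀ {n D} σ (e : Vec ℕ n) → (∀ i → lookup e i ℕ.≤ D) → evalCoeffs D σ (monCoeff F e) ≈ evalMon σ e
  evalCoeffs-mon         σ []      le = monCoeff-refl []
  evalCoeffs-mon {D = D} σ (x ∷ e) le = trans
    (sumTo-single (suc D) x (λ j → σ zero ^ j * evalCoeffs D (σ ∘ suc) (λ m → monCoeff F (x ∷ e) (j ∷ m))) (s≤s (le zero)) (λ j j≢x →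
      trans (*-congˡ (evalCoeffs-0 D (σ ∘ suc) (λ m → monCoeff-≢ {e = x ∷ e} {j ∷ m} (λ { ≡.refl → j≢x ≡.refl })))) (zeroʳ (σ zero ^ j))))
    (*-congˡ (trans (evalCoeffs-cong D (σ ∘ suc) (monCoeff-cons x e)) (evalCoeffs-mon (σ ∘ suc) e (le ∘ suc))))

  evalMon-0 : ∀ {n} (σ : Fin n → Carrier) → evalMon σ (replicate n 0) ≈ 1#
  evalMon-0 {zero}  σ = refl
  evalMon-0 {suc n} σ = trans (*-identityˡ _) (evalMon-0 (σ ∘ suc))

  evalMon-unit : ∀ {n} (σ : Fin n → Carrier) i → evalMon σ (unitMon F i) ≈ σ i
  evalMon-unit σ zero    = trans (*-cong (*-identityʳ _) (evalMon-0 (σ ∘ suc))) (*-identityʳ _)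
  evalMon-unit σ (suc i) = trans (*-identityˡ _) (evalMon-unit (σ ∘ suc) i)

  unitMon≤1 : ∀ {n} (i j : Fin n) → lookup (unitMon F i) j ℕ.≤ 1
  unitMon≤1 zero    zero    = ℕₚ.≤-refl
  unitMon≤1 zero    (suc j) = ℕₚ.≤-trans (ℕₚ.≤-reflexive (lookup-replicate j 0)) z≤n
  unitMon≤1 (suc i) zero    = z≤n
  unitMon≤1 (suc i) (suc j) = unitMon≤1 i j

  replicate0≤ : ∀ {n} (j : Fin n) D → lookup (replicate n 0) j ℕ.≤ D
  replicate0≤ j D = ℕₚ.≤-trans (ℕₚ.≤-reflexive (lookup-replicate j 0)) z≤n

  degree-mon : ∀ {n D} (e : Vec ℕ n) → (∀ i → lookup e i ℕ.≤ D) → DegreeBound D (monCoeff F e)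
  degree-mon e le m i lt = monCoeff-≢ {e = e} {m} (λ { ≡.refl → ℕₚ.<⇒≱ lt (le i) })

  mutual
    degree-coeff : ∀ {n} (f : Formula F n) → DegreeBound (size F f) (coeff F f)
    degree-coeff (var i)    = degree-mon (unitMon F i) (unitMon≤1 i)
    degree-coeff (const c)  m i lt =
      trans (*-congˡ (degree-mon (replicate _ 0) (λ j → replicate0≤ j 1) m i lt)) (zeroʳ c)
    degree-coeff (sumG gs)  m i lt = degree-coeffSum gs m i (ℕₚ.<-trans (ℕₚ.n<1+n _) lt)
    degree-coeff (prodG gs) m i lt = degree-coeffProd gs m i (ℕₚ.<-trans (ℕₚ.n<1+n _) lt)

    degree-coeffSum : ∀ {n} (gs : List (Formula F n)) → DegreeBound (sizes F gs) (coeffSum F gs)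
    degree-coeffSum []       m i lt = refl
    degree-coeffSum (g ∷ gs) m i lt = trans
      (+-cong (degree-coeff g m i (ℕₚ.≤-<-trans (ℕₚ.m≤m+n _ _) lt))
              (degree-coeffSum gs m i (ℕₚ.≤-<-trans (ℕₚ.m≤n+m _ _) lt)))
      (+-identityˡ 0#)

    degree-coeffProd : ∀ {n} (gs : List (Formula F n)) → DegreeBound (sizes F gs) (coeffProd F gs)
    degree-coeffProd []       = degree-mon (replicate _ 0) (λ j → replicate0≤ j 0)
    degree-coeffProd (g ∷ gs) = degree-conv {c = coeff F g} {coeffProd F gs} (degree-coeff g) (degree-coeffProd gs)

  mutual
    evalCoeffs-coeff : ∀ {n D} σ (f : Formula F n) → size F f ℕ.≤ D → evalCoeffs D σ (coeff F f) ≈ eval f σ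
    evalCoeffs-coeff σ (var i) le =
      trans (evalCoeffs-mon σ (unitMon F i) (λ j → ℕₚ.≤-trans (unitMon≤1 i j) le)) (evalMon-unit σ i)
    evalCoeffs-coeff {D = D} σ (const c) le = trans (evalCoeffs-* D σ c _)
      (trans (*-congˡ (trans (evalCoeffs-mon σ (replicate _ 0) (λ j → replicate0≤ j D)) (evalMon-0 σ))) (*-identityʳ c))
    evalCoeffs-coeff σ (sumG gs)  le = evalCoeffs-coeffSum σ gs (ℕₚ.≤-trans (ℕₚ.n≤1+n _) le)
    evalCoeffs-coeff σ (prodG gs) le = evalCoeffs-coeffProd σ gs (ℕₚ.≤-trans (ℕₚ.n≤1+n _) le)

    evalCoeffs-coeffSum : ∀ {n D} σ (gs : List (Formula F n)) → sizes F gs ℕ.≤ D →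
      evalCoeffs D σ (coeffSum F gs) ≈ evalSum gs σ
    evalCoeffs-coeffSum {D = D} σ []       le = evalCoeffs-0 D σ (λ _ → refl)
    evalCoeffs-coeffSum {D = D} σ (g ∷ gs) le = trans (evalCoeffs-+ D σ (coeff F g) (coeffSum F gs))
      (+-cong (evalCoeffs-coeff σ g (ℕₚ.m+n≤o⇒m≤o _ le)) (evalCoeffs-coeffSum σ gs (ℕₚ.m+n≤o⇒n≤o _ le)))

    evalCoeffs-coeffProd : ∀ {n D} σ (gs : List (Formula F n)) → sizes F gs ℕ.≤ D →
      evalCoeffs D σ (coeffProd F gs) ≈ evalProd gs σ
    evalCoeffs-coeffProd {D = D} σ []       le =
      trans (evalCoeffs-mon σ (replicate _ 0) (λ j → replicate0≤ j D)) (evalMon-0 σ)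
    evalCoeffs-coeffProd {D = D} σ (g ∷ gs) le = trans
      (evalCoeffs-conv σ {coeff F g} {coeffProd F gs} (degree-coeff g) (degree-coeffProd gs) le)
      (*-cong (evalCoeffs-coeff σ g (ℕₚ.m+n≤o⇒m≤o _ le)) (evalCoeffs-coeffProd σ gs (ℕₚ.m+n≤o⇒n≤o _ le)))

  -- Cutting at the sum of both sizes, hence above the degrees of both polynomials, turns the
  -- truncations into the values themselves. The hypothesis compares coefficients, while the rank
  -- argument substitutes points.
  samePoly⇒eval≈ : ∀ {n} (f g : Formula F n) → SamePoly F f g → ∀ σ → eval f σ ≈ eval g σ
  samePoly⇒eval≈ f g same σ = trans (sym (evalCoeffs-coeff σ f (ℕₚ.m≤m+n (size F f) (size F g))))
    (trans (evalCoeffs-cong _ σ same) (evalCoeffs-coeff σ g (ℕₚ.m≤n+m (size F g) (size F f))))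

-- Upper bounds on matrix rank.

module Rank {a ℓ : Level} (F : Field a ℓ) where
  open Field F hiding (zero)
  open import Relation.Binary.Reasoning.Setoid setoid
  open import Algebra.Solver.Ring.NaturalCoefficients.Default commutativeSemiring using (solve; _:+_; _:*_; _:=_; con)

  Dyads : Set → Set → Set a
  Dyads R C = List ((R → Carrier) × (C → Carrier))

  sumDyads : ∀ {R C} → Dyads R C → R → C → Carrier
  sumDyads []            x y = 0#
  sumDyads ((u , v) ∷ l) x y = u x * v y + sumDyads l x y

  -- Rank is bounded by exhibiting rank-one terms, so that upper bounds are built without
  -- elimination and without deciding equality in the field.
  RankLe : ∀ {R C : Set} → (R → C → Carrier) → ℕ → Set (a ⊔ ℓ)
  RankLe {R} {C} φ r = Σ (Dyads R C) λ l → length l ℕ.≤ r × (∀ x y → φ x y ≈ sumDyads l x y)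

  rank-cong : ∀ {R C r} {φ ψ : R → C → Carrier} → (∀ x y → φ x y ≈ ψ x y) → RankLe ψ r → RankLe φ r
  rank-cong eq (l , len , ψ≈) = l , len , λ x y → trans (eq x y) (ψ≈ x y)

  rank-mono : ∀ {R C r s} {φ : R → C → Carrier} → r ℕ.≤ s → RankLe φ r → RankLe φ s
  rank-mono r≤s (l , len , φ≈) = l , ℕₚ.≤-trans len r≤s , φ≈

  sumDyads-++ : ∀ {R C} (l l′ : Dyads R C) x y → sumDyads (l ++ l′) x y ≈ sumDyads l x y + sumDyads l′ x y
  sumDyads-++ []      l′ x y = sym (+-identityˡ _)
  sumDyads-++ (_ ∷ l) l′ x y = trans (+-congˡ (sumDyads-++ l l′ x y)) (sym (+-assoc _ _ _))

  rank-+ : ∀ {R C r s} {φ ψ : R → C → Carrier} → RankLe φ r → RankLe ψ s → RankLe (λ x y → φ x y + ψ x y) (r ℕ.+ s)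
  rank-+ (l , len , φ≈) (l′ , len′ , ψ≈) = l ++ l′ ,
    ℕₚ.≤-trans (ℕₚ.≤-reflexive (length-++ l)) (ℕₚ.+-mono-≤ len len′) ,
    λ x y → trans (+-cong (φ≈ x y) (ψ≈ x y)) (sym (sumDyads-++ l l′ x y))

  scaleDyads : ∀ {R C} → (R → Carrier) → (C → Carrier) → Dyads R C → Dyads R C
  scaleDyads p q = List.map (λ (u , v) → (λ x → p x * u x) , (λ y → q y * v y))

  sumDyads-scale : ∀ {R C} p q (l : Dyads R C) x y → sumDyads (scaleDyads p q l) x y ≈ p x * q y * sumDyads l x y
  sumDyads-scale p q []            x y = sym (zeroʳ _)
  sumDyads-scale p q ((u , v) ∷ l) x y = trans (+-congˡ (sumDyads-scale p q l x y))
    (solve 5 (λ p q u v s → p :* u :* (q :* v) :+ p :* q :* s := p :* q :* (u :* v :+ s)) refl (p x) (q y) (u x) (v y) _)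

  _⊛_ : ∀ {R C} → Dyads R C → Dyads R C → Dyads R C
  []            ⊛ l′ = []
  ((u , v) ∷ l) ⊛ l′ = scaleDyads u v l′ ++ (l ⊛ l′)

  length-⊛ : ∀ {R C} (l l′ : Dyads R C) → length (l ⊛ l′) ≡ length l ℕ.* length l′
  length-⊛ []            l′ = ≡.refl
  length-⊛ ((u , v) ∷ l) l′ = ≡.trans (length-++ (scaleDyads u v l′)) (≡.cong₂ ℕ._+_ (length-map _ l′) (length-⊛ l l′))

  sumDyads-⊛ : ∀ {R C} (l l′ : Dyads R C) x y → sumDyads (l ⊛ l′) x y ≈ sumDyads l x y * sumDyads l′ x y
  sumDyads-⊛ []            l′ x y = sym (zeroˡ _)
  sumDyads-⊛ ((u , v) ∷ l) l′ x y = trans (sumDyads-++ (scaleDyads u v l′) (l ⊛ l′) x y)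
    (trans (+-cong (sumDyads-scale u v l′ x y) (sumDyads-⊛ l l′ x y)) (sym (distribʳ _ _ _)))

  -- The entrywise product of two dyads is a dyad. A product gate multiplies values at the same row
  -- and column, so the entrywise product is the relevant one.
  rank-* : ∀ {R C r s} {φ ψ : R → C → Carrier} → RankLe φ r → RankLe ψ s → RankLe (λ x y → φ x y * ψ x y) (r ℕ.* s)
  rank-* (l , len , φ≈) (l′ , len′ , ψ≈) = l ⊛ l′ ,
    ℕₚ.≤-trans (ℕₚ.≤-reflexive (length-⊛ l l′)) (ℕₚ.*-mono-≤ len len′) ,
    λ x y → trans (*-cong (φ≈ x y) (ψ≈ x y)) (sym (sumDyads-⊛ l l′ x y))

  rank-row : ∀ {R C} (α : R → Carrier) → RankLe {R} {C} (λ x _ → α x) 1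
  rank-row α = (α , (λ _ → 1#)) ∷ [] , ℕₚ.≤-refl , λ x y → solve 1 (λ u → u := u :* con 1 :+ con 0) refl (α x)

  rank-col : ∀ {R C} (β : C → Carrier) → RankLe {R} {C} (λ _ y → β y) 1
  rank-col β = ((λ _ → 1#) , β) ∷ [] , ℕₚ.≤-refl , λ x y → solve 1 (λ u → u := con 1 :* u :+ con 0) refl (β y)

  rank-precomp : ∀ {R R′ C : Set} {r} (f : R′ → R) {φ : R → C → Carrier} → RankLe φ r → RankLe (λ x y → φ (f x) y) r
  rank-precomp {R} {R′} {C} f {φ} (l , len , φ≈) = go l ,
    ℕₚ.≤-trans (ℕₚ.≤-reflexive (length-map _ l)) len , λ x y → trans (φ≈ (f x) y) (eq l x y)
    where
    go : Dyads R C → Dyads R′ C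
    go = List.map (λ (u , v) → u ∘ f , v)
    eq : ∀ l x y → sumDyads l (f x) y ≈ sumDyads (go l) x y
    eq []      x y = refl
    eq (_ ∷ l) x y = +-congˡ (eq l x y)

  rank-swap : ∀ {R C : Set} {r} {φ : R → C → Carrier} → RankLe φ r → RankLe (λ y x → φ x y) r
  rank-swap {R} {C} (l , len , φ≈) = go l ,
    ℕₚ.≤-trans (ℕₚ.≤-reflexive (length-map _ l)) len , λ y x → trans (φ≈ x y) (eq l x y)
    where
    go : Dyads R C → Dyads C R
    go = List.map (λ (u , v) → v , u)
    eq : ∀ l x y → sumDyads l x y ≈ sumDyads (go l) y x
    eq []      x y = refl
    eq (_ ∷ l) x y = +-cong (*-comm _ _) (eq l x y)

  bit : Bool → Carrier
  bit b = if b then 1# else 0#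

  -- Rows that agree on `U` coincide, which leaves at most 2^|U| different ones. The recursion
  -- separates the two values of a bit by their indicators.
  rank-cube : ∀ {n} {C : Set} (U : Vec Bool n) (φ : Vec Bool n → C → Carrier) →
    RankLe (λ x y → φ (x ∩ U) y) (2 ℕ.^ card U)
  rank-cube []          φ = rank-cong (λ { [] y → refl }) (rank-col (φ []))
  rank-cube (false ∷ U) φ = rank-cong (λ { (true ∷ x) y → refl ; (false ∷ x) y → refl })
    (rank-precomp Vec.tail (rank-cube U (λ x → φ (false ∷ x))))
  rank-cube (true ∷ U)  φ = rank-mono (ℕₚ.≤-reflexive (≡.trans (≡.cong₂ ℕ._+_ (ℕₚ.*-identityˡ (2 ℕ.^ card U)) (ℕₚ.*-identityˡ (2 ℕ.^ card U))) (≡.sym (2^suc (card U)))))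
    (rank-cong split (rank-+ (half true (λ x → bit (Vec.head x))) (half false (λ x → bit (not (Vec.head x))))))
    where
    half : ∀ b α → RankLe (λ x y → α x * φ (b ∷ (Vec.tail x ∩ U)) y) (1 ℕ.* 2 ℕ.^ card U)
    half b α = rank-* (rank-row α) (rank-precomp Vec.tail (rank-cube U (λ x → φ (b ∷ x))))
    split : ∀ x y → φ (x ∩ (true ∷ U)) y ≈
      bit (Vec.head x) * φ (true ∷ (Vec.tail x ∩ U)) y + bit (not (Vec.head x)) * φ (false ∷ (Vec.tail x ∩ U)) y
    split (true  ∷ x) y = solve 2 (λ p q → p := con 1 :* p :+ con 0 :* q) refl _ (φ (false ∷ (x ∩ U)) y)
    split (false ∷ x) y = solve 2 (λ p q → p := con 0 :* q :+ con 1 :* p) refl _ (φ (true ∷ (x ∩ U)) y)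

-- Random restrictions of formulas.

module Restriction {a ℓ : Level} (F : Field a ℓ) {d N : ℕ} (ι : Fin d → Fin N)
  (main : Fin N → Maybe (Fin d)) (main-ι : ∀ {v i} → main v ≡ just i → v ≡ ι i) where
  open Field F hiding (zero)
  open Evaluation F
  open Rank F

  mutual
    occ : Fin N → Formula F N → Bool
    occ v (var u)    = does (v Fin.≟ u)
    occ v (const c)  = false
    occ v (sumG gs)  = occs v gs
    occ v (prodG gs) = occs v gs

    occs : Fin N → List (Formula F N) → Bool
    occs v []       = false
    occs v (g ∷ gs) = occ v g ∨ occs v gs

  mutual
    occ⇒Occurs : ∀ v g → occ v g ≡ true → Occurs F v g
    occ⇒Occurs v (var u) eq with v Fin.≟ u
    occ⇒Occurs v (var u) eq | yes ≡.refl = here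
    occ⇒Occurs v (sumG gs)  eq = inSum (occs⇒Occurs v gs eq)
    occ⇒Occurs v (prodG gs) eq = inProd (occs⇒Occurs v gs eq)

    occs⇒Occurs : ∀ v gs → occs v gs ≡ true → Any (Occurs F v) gs
    occs⇒Occurs v (g ∷ gs) eq with occ v g in eqg
    ... | true  = here (occ⇒Occurs v g eqg)
    ... | false = there (occs⇒Occurs v gs eq)

  occs-head : ∀ {v g gs} → occ v g ≡ true → occs v (g ∷ gs) ≡ true
  occs-head {v} {g} eq rewrite eq = ≡.refl

  occs-tail : ∀ {v g gs} → occs v gs ≡ true → occs v (g ∷ gs) ≡ true
  occs-tail {v} {g} eq with occ v g
  ... | true  = ≡.refl
  ... | false = eq

  mutual
    eval-local : ∀ g {σ τ} → (∀ v → occ v g ≡ true → σ v ≈ τ v) → eval g σ ≈ eval g τ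
    eval-local (var u) eq = eq u (self u)
      where
      self : ∀ u → does (u Fin.≟ u) ≡ true
      self u with u Fin.≟ u
      ... | yes _  = ≡.refl
      ... | no u≢u = contradiction ≡.refl u≢u
    eval-local (const c)  eq = refl
    eval-local (sumG gs)  eq = evalSum-local gs eq
    eval-local (prodG gs) eq = evalProd-local gs eq

    evalSum-local : ∀ gs {σ τ} → (∀ v → occs v gs ≡ true → σ v ≈ τ v) → evalSum gs σ ≈ evalSum gs τ
    evalSum-local []       eq = refl
    evalSum-local (g ∷ gs) eq = +-cong (eval-local g (λ v o → eq v (occs-head {v} {g} {gs} o)))
                                       (evalSum-local gs (λ v o → eq v (occs-tail {v} {g} {gs} o)))

    evalProd-local : ∀ gs {σ τ} → (∀ v → occs v gs ≡ true → σ v ≈ τ v) → evalProd gs σ ≈ evalProd gs τ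
    evalProd-local []       eq = refl
    evalProd-local (g ∷ gs) eq = *-cong (eval-local g (λ v o → eq v (occs-head {v} {g} {gs} o)))
                                        (evalProd-local gs (λ v o → eq v (occs-tail {v} {g} {gs} o)))

  -- The main variables indexed by A stay alive: those in κ are read off the row x, the others
  -- off the column y.  All remaining variables are set to the constants c.
  module _ (A κ x y : Vec Bool d) where
    choose : Maybe (Fin d) → Carrier → Carrier
    choose nothing  k = k
    choose (just i) k = if lookup A i then bit (if lookup κ i then lookup x i else lookup y i) else k

  point : (A κ : Vec Bool d) (c : Fin N → Carrier) (x y : Vec Bool d) → Fin N → Carrier
  point A κ c x y v = choose A κ x y (main v) (c v)

  Family : Set a
  Family = (A κ : Vec Bool d) (c : Fin N → Carrier) (x y : Vec Bool d) → Carrier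

  -- The bound is uniform in the split and the constants because the lower bound picks both
  -- depending on `A`.
  RankBound : Family → Vec Bool d → ℕ → Set (a ⊔ ℓ)
  RankBound Φ A r = ∀ κ c → RankLe (Φ A κ c) r

  ⟦_⟧ : Formula F N → Family
  ⟦ g ⟧ A κ c x y = eval g (point A κ c x y)

  ⟦_⟧Σ ⟦_⟧Π : List (Formula F N) → Family
  ⟦ gs ⟧Σ A κ c x y = evalSum gs (point A κ c x y)
  ⟦ gs ⟧Π A κ c x y = evalProd gs (point A κ c x y)

  VarsIn : Formula F N → Vec Bool d → Set
  VarsIn g X = ∀ i → occ (ι i) g ≡ true → lookup X i ≡ true

  lookup-∩ : ∀ {n} (X Y : Vec Bool n) i → lookup (X ∩ Y) i ≡ lookup X i ∧ lookup Y i
  lookup-∩ X Y i = lookup-zipWith _∧_ i X Y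

  -- The live main variables of `g` lie in A ∩ X. Rows or columns own at most half of that set,
  -- rounded down, and the rank is at most the number of settings of the smaller side. The rounding
  -- is what produces the loss at odd shares.
  rank-trivial : ∀ g {X} → VarsIn g X → ∀ A → RankBound ⟦ g ⟧ A (2 ℕ.^ ⌊ card (A ∩ X) /2⌋)
  rank-trivial g {X} g⊆X A κ c with half-+ {a = card ((A ∩ X) ∩ κ)} {card ((A ∩ X) ∩ Vec.map not κ)} (ℕₚ.≤-reflexive (≡.sym (split-cardX (split-∩ (A ∩ X) κ))))
  ... | inj₁ rows = rank-mono (ℕₚ.^-monoʳ-≤ 2 rows)
          (rank-cong (λ x y → eval-local g (agree x y)) (rank-cube U (λ x y → ⟦ g ⟧ A κ c x y)))
    where
    U = (A ∩ X) ∩ κ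
    agree : ∀ x y v → occ v g ≡ true → point A κ c x y v ≈ point A κ c (x ∩ U) y v
    agree x y v o with main v in eq
    ... | nothing = refl
    ... | just i with lookup A i in eqA | lookup κ i in eqκ
    ...   | false | _     = refl
    ...   | true  | false = refl
    ...   | true  | true  = reflexive (≡.cong bit (≡.sym (≡.trans (lookup-∩ x U i) (≡.trans (≡.cong (lookup x i ∧_) inU) (∧-identityʳ (lookup x i))))))
      where
      inX = g⊆X i (≡.subst (λ w → occ w g ≡ true) (main-ι eq) o)
      inU : lookup U i ≡ true
      inU = ≡.trans (lookup-∩ (A ∩ X) κ i) (≡.cong₂ _∧_ (≡.trans (lookup-∩ A X i) (≡.cong₂ _∧_ eqA inX)) eqκ)
  ... | inj₂ cols = rank-mono (ℕₚ.^-monoʳ-≤ 2 cols)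
          (rank-cong (λ x y → eval-local g (agree x y)) (rank-swap (rank-cube U (λ y x → ⟦ g ⟧ A κ c x y))))
    where
    U = (A ∩ X) ∩ Vec.map not κ
    agree : ∀ x y v → occ v g ≡ true → point A κ c x y v ≈ point A κ c x (y ∩ U) v
    agree x y v o with main v in eq
    ... | nothing = refl
    ... | just i with lookup A i in eqA | lookup κ i in eqκ
    ...   | false | _     = refl
    ...   | true  | true  = refl
    ...   | true  | false = reflexive (≡.cong bit (≡.sym (≡.trans (lookup-∩ y U i) (≡.trans (≡.cong (lookup y i ∧_) inU) (∧-identityʳ (lookup y i))))))
      where
      inX = g⊆X i (≡.subst (λ w → occ w g ≡ true) (main-ι eq) o)
      inU : lookup U i ≡ true
      inU = ≡.trans (lookup-∩ (A ∩ X) (Vec.map not κ) i)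
        (≡.cong₂ _∧_ (≡.trans (lookup-∩ A X i) (≡.cong₂ _∧_ eqA inX)) (≡.trans (lookup-map i not κ) (≡.cong not eqκ)))

  -- A linear form never multiplies a row by a column variable, so its rank is at most 2 whatever
  -- its length.
  Separable : (Vec Bool d → Vec Bool d → Carrier) → Set (a ⊔ ℓ)
  Separable φ = ∃₂ λ (α β : Vec Bool d → Carrier) → ∀ x y → φ x y ≈ α x + β y

  separable-input : ∀ {g} → IsInput F g → ∀ A κ c → Separable (⟦ g ⟧ A κ c)
  separable-input (const k) A κ c = (λ _ → k) , (λ _ → 0#) , λ x y → sym (+-identityʳ k)
  separable-input (var v)   A κ c with main v
  ... | nothing = (λ _ → c v) , (λ _ → 0#) , λ x y → sym (+-identityʳ _)
  ... | just i with lookup A i | lookup κ i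
  ...   | false | _     = (λ _ → c v) , (λ _ → 0#) , λ x y → sym (+-identityʳ _)
  ...   | true  | true  = (λ x → bit (lookup x i)) , (λ _ → 0#) , λ x y → sym (+-identityʳ _)
  ...   | true  | false = (λ _ → 0#) , (λ y → bit (lookup y i)) , λ x y → sym (+-identityˡ _)

  separable-sum : ∀ {gs} → All (IsInput F) gs → ∀ A κ c → Separable (⟦ gs ⟧Σ A κ c)
  separable-sum []         A κ c = (λ _ → 0#) , (λ _ → 0#) , λ x y → sym (+-identityˡ 0#)
  separable-sum (in₁ ∷ ins) A κ c with separable-input in₁ A κ c | separable-sum ins A κ c
  ... | α , β , eq | α′ , β′ , eq′ = (λ x → α x + α′ x) , (λ y → β y + β′ y) , λ x y →
    trans (+-cong (eq x y) (eq′ x y)) (solve 4 (λ p q r s → p :+ q :+ (r :+ s) := p :+ r :+ (q :+ s)) refl (α x) (β y) (α′ x) (β′ y))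
    where open import Algebra.Solver.Ring.NaturalCoefficients.Default commutativeSemiring using (solve; _:+_; _:*_; _:=_; con)

  rank-linear : ∀ {gs} → All (IsInput F) gs → ∀ A → RankBound ⟦ gs ⟧Σ A 2
  rank-linear ins A κ c with separable-sum ins A κ c
  ... | α , β , eq = rank-cong eq (rank-+ (rank-row α) (rank-col β))

-- Comparing averages with different savings.

module Averages where
  open import Data.Nat
  open ℕₚ
  open ≡
  open +-*-Solver using (solve; _:+_; _:*_; _:=_; con)

  module _ {s T w : ℕ} where
    open ≤-Reasoning

    average-weaken : ∀ {S S′ D D′} → S ≤ S′ → D′ ≤ D →
      s * 8 ^ D ≤ T * (S * 7 ^ D * w) → s * 8 ^ D′ ≤ T * (S′ * 7 ^ D′ * w)
    average-weaken {S} {S′} {D} {D′} S≤ D′≤D le = *-cancelʳ-≤ _ _ (8 ^ e) {{m^n≢0 8 e}} (begin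
      s * 8 ^ D′ * 8 ^ e                  ≡⟨ *-assoc s _ _ ⟩
      s * (8 ^ D′ * 8 ^ e)                ≡⟨ cong (s *_) (pow 8) ⟩
      s * 8 ^ D                           ≤⟨ le ⟩
      T * (S * 7 ^ D * w)                 ≤⟨ *-monoʳ-≤ T (*-monoˡ-≤ w (*-monoˡ-≤ (7 ^ D) S≤)) ⟩
      T * (S′ * 7 ^ D * w)                ≡⟨ cong (λ z → T * (S′ * z * w)) (sym (pow 7)) ⟩
      T * (S′ * (7 ^ D′ * 7 ^ e) * w)     ≤⟨ *-monoʳ-≤ T (*-monoˡ-≤ w (*-monoʳ-≤ S′ (*-monoʳ-≤ (7 ^ D′) (^-monoˡ-≤ e (n≤1+n 7))))) ⟩
      T * (S′ * (7 ^ D′ * 8 ^ e) * w)     ≡⟨ solve 5 (λ t a p q c → t :* (a :* (p :* q) :* c) := t :* (a :* p :* c) :* q) refl T S′ (7 ^ D′) (8 ^ e) w ⟩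
      T * (S′ * 7 ^ D′ * w) * 8 ^ e       ∎)
      where
      e = D ∸ D′
      pow : ∀ m → m ^ D′ * m ^ e ≡ m ^ D
      pow m = trans (sym (^-distribˡ-+-* m D′ e)) (cong (m ^_) (m+[n∸m]≡n D′≤D))

    cancel-factor : ∀ {P Q u v} → 0 < P → 2 * Q ≤ P → s * (P * u) ≤ T * (2 * (Q * v) * w) → s * u ≤ T * (1 * v * w)
    cancel-factor {P} {Q} {u} {v} 0<P 2Q≤P le = *-cancelˡ-≤ P {{>-nonZero 0<P}} (begin
      P * (s * u)                ≡⟨ solve 3 (λ p a b → p :* (a :* b) := a :* (p :* b)) refl P s u ⟩
      s * (P * u)                ≤⟨ le ⟩
      T * (2 * (Q * v) * w)      ≡⟨ solve 4 (λ t q a b → t :* (con 2 :* (q :* a) :* b) := con 2 :* q :* (t :* (con 1 :* a :* b))) refl T Q v w ⟩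
      2 * Q * (T * (1 * v * w))  ≤⟨ *-monoˡ-≤ _ 2Q≤P ⟩
      P * (T * (1 * v * w))      ∎)


open Averages

-- Expected relative rank of formulas.

module UpperBound {a ℓ : Level} (F : Field a ℓ) {d N : ℕ} (ι : Fin d → Fin N)
  (main : Fin N → Maybe (Fin d)) (main-ι : ∀ {v i} → main v ≡ just i → v ≡ ι i) where
  open Field F using () renaming (_+_ to _+ᶠ_; _*_ to _*ᶠ_)
  open import Data.Nat hiding (_⊔_)
  open ℕₚ
  open ≡
  open +-*-Solver using (solve; _:+_; _:*_; _:=_; con)
  open Evaluation F
  open Rank F
  open Restriction F ι main main-ι
  open ≤-Reasoning

  -- weight (A ∩ X) / scale bounds the rank of Φ A relative to h, and its mean over uniformly
  -- random A is at most S·(7/8)^D.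
  record Bound (Φ : Family) (X : Vec Bool d) (S D : ℕ) : Set (a ⊔ ℓ) where
    field
      rank    : Vec Bool d → ℕ
      weight  : Vec Bool d → ℕ
      scale   : ℕ
      scale>0 : 0 < scale
      rank≤   : ∀ A → RankBound Φ A (rank A)
      local   : ∀ A → rank A * (3 * scale) ≤ weight (A ∩ X) * h (card (A ∩ X))
      average : sumSub (λ A → weight (A ∩ X)) * 8 ^ D ≤ 2 ^ d * (S * 7 ^ D * scale)

  bound-weaken : ∀ {Φ X S S′ D D′} → S ≤ S′ → D′ ≤ D → Bound Φ X S D → Bound Φ X S′ D′
  bound-weaken {X = X} S≤ D≤ B = record { Bound B ; average = average-weaken {s = sumSub (λ A → Bound.weight B (A ∩ X))} {2 ^ d} {Bound.scale B} S≤ D≤ (Bound.average B) }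

  bound-0 : ∀ {Φ X D} → (∀ A → RankBound Φ A 0) → Bound Φ X 0 D
  bound-0 {D = D} rk = record
    { rank = λ _ → 0 ; weight = λ _ → 0 ; scale = 1 ; scale>0 = ≤-refl ; rank≤ = rk ; local = λ _ → z≤n
    ; average = ≤-trans (≤-reflexive (cong (_* 8 ^ D) (trans (sumSub-const d 0) (*-zeroʳ (2 ^ d))))) z≤n }

  bound-+ : ∀ {Φ Ψ X S T D} → Bound Φ X S D → Bound Ψ X T D →
    Bound (λ A κ c x y → Φ A κ c x y +ᶠ Ψ A κ c x y) X (S + T) D
  bound-+ {X = X} {S} {T} {D} B₁ B₂ = record
    { rank    = λ A → B₁.rank A + B₂.rank A
    ; weight  = λ A → B₁.weight A * B₂.scale + B₂.weight A * B₁.scale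
    ; scale   = B₁.scale * B₂.scale
    ; scale>0 = *-mono-< {0} {_} {0} B₁.scale>0 B₂.scale>0
    ; rank≤   = λ A κ c → rank-+ (B₁.rank≤ A κ c) (B₂.rank≤ A κ c)
    ; local   = λ A → begin
        (B₁.rank A + B₂.rank A) * (3 * (B₁.scale * B₂.scale))
          ≡⟨ solve 4 (λ r s c e → (r :+ s) :* (con 3 :* (c :* e)) := r :* (con 3 :* c) :* e :+ s :* (con 3 :* e) :* c) refl (B₁.rank A) (B₂.rank A) B₁.scale B₂.scale ⟩
        B₁.rank A * (3 * B₁.scale) * B₂.scale + B₂.rank A * (3 * B₂.scale) * B₁.scale
          ≤⟨ +-mono-≤ (*-monoˡ-≤ B₂.scale (B₁.local A)) (*-monoˡ-≤ B₁.scale (B₂.local A)) ⟩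
        B₁.weight (A ∩ X) * H A * B₂.scale + B₂.weight (A ∩ X) * H A * B₁.scale
          ≡⟨ solve 5 (λ u v w c e → u :* w :* e :+ v :* w :* c := (u :* e :+ v :* c) :* w) refl (B₁.weight (A ∩ X)) (B₂.weight (A ∩ X)) (H A) B₁.scale B₂.scale ⟩
        (B₁.weight (A ∩ X) * B₂.scale + B₂.weight (A ∩ X) * B₁.scale) * H A ∎
    ; average = begin
        sumSub (λ A → B₁.weight (A ∩ X) * B₂.scale + B₂.weight (A ∩ X) * B₁.scale) * 8 ^ D
          ≡⟨ cong (_* 8 ^ D) (trans (sumSub-+ (λ A → B₁.weight (A ∩ X) * B₂.scale) (λ A → B₂.weight (A ∩ X) * B₁.scale))
              (cong₂ _+_ (sumSub-*ʳ (λ A → B₁.weight (A ∩ X)) B₂.scale) (sumSub-*ʳ (λ A → B₂.weight (A ∩ X)) B₁.scale))) ⟩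
        (s₁ * B₂.scale + s₂ * B₁.scale) * 8 ^ D
          ≡⟨ solve 5 (λ u v c e p → (u :* e :+ v :* c) :* p := u :* p :* e :+ v :* p :* c) refl s₁ s₂ B₁.scale B₂.scale (8 ^ D) ⟩
        s₁ * 8 ^ D * B₂.scale + s₂ * 8 ^ D * B₁.scale
          ≤⟨ +-mono-≤ (*-monoˡ-≤ B₂.scale B₁.average) (*-monoˡ-≤ B₁.scale B₂.average) ⟩
        2 ^ d * (S * 7 ^ D * B₁.scale) * B₂.scale + 2 ^ d * (T * 7 ^ D * B₂.scale) * B₁.scale
          ≡⟨ solve 6 (λ t u v p c e → t :* (u :* p :* c) :* e :+ t :* (v :* p :* e) :* c := t :* ((u :+ v) :* p :* (c :* e))) refl (2 ^ d) S T (7 ^ D) B₁.scale B₂.scale ⟩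
        2 ^ d * ((S + T) * 7 ^ D * (B₁.scale * B₂.scale)) ∎
    }
    where
    module B₁ = Bound B₁
    module B₂ = Bound B₂
    H : Vec Bool d → ℕ
    H A = h (card (A ∩ X))
    s₁ = sumSub (λ A → B₁.weight (A ∩ X))
    s₂ = sumSub (λ A → B₂.weight (A ∩ X))

  -- By `h-mult` relative ranks multiply, and the weights read the disjoint sets `Y` and `Z`, so by
  -- `sumSub-split` their means multiply too. Hence coefficients multiply and savings add.
  bound-* : ∀ {Φ Ψ X Y Z S T D E} → Split X Y Z → Bound Φ Y S D → Bound Ψ Z T E →
    Bound (λ A κ c x y → Φ A κ c x y *ᶠ Ψ A κ c x y) X (S * T) (D + E)
  bound-* {X = X} {Y} {Z} {S} {T} {D} {E} split B₁ B₂ = record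
    { rank    = λ A → B₁.rank A * B₂.rank A
    ; weight  = weight
    ; scale   = B₁.scale * B₂.scale
    ; scale>0 = *-mono-< {0} {_} {0} B₁.scale>0 B₂.scale>0
    ; rank≤   = λ A κ c → rank-* (B₁.rank≤ A κ c) (B₂.rank≤ A κ c)
    ; local   = λ A → *-cancelˡ-≤ 3 (begin
        3 * (B₁.rank A * B₂.rank A * (3 * (B₁.scale * B₂.scale)))
          ≡⟨ solve 4 (λ r s c e → con 3 :* (r :* s :* (con 3 :* (c :* e))) := r :* (con 3 :* c) :* (s :* (con 3 :* e))) refl (B₁.rank A) (B₂.rank A) B₁.scale B₂.scale ⟩
        B₁.rank A * (3 * B₁.scale) * (B₂.rank A * (3 * B₂.scale))
          ≤⟨ *-mono-≤ (B₁.local A) (B₂.local A) ⟩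
        w₁ A * h (card (A ∩ Y)) * (w₂ A * h (card (A ∩ Z)))
          ≡⟨ solve 4 (λ u p v q → u :* p :* (v :* q) := u :* v :* (p :* q)) refl (w₁ A) (h (card (A ∩ Y))) (w₂ A) (h (card (A ∩ Z))) ⟩
        w₁ A * w₂ A * (h (card (A ∩ Y)) * h (card (A ∩ Z)))
          ≤⟨ *-monoʳ-≤ (w₁ A * w₂ A) (h-mult (card (A ∩ Y)) (card (A ∩ Z))) ⟩
        w₁ A * w₂ A * (3 * h (card (A ∩ Y) + card (A ∩ Z)))
          ≡⟨ cong₂ (λ u k → u * (3 * h k)) (sym (weight-∩ A)) (sym (split-card split A)) ⟩
        weight (A ∩ X) * (3 * h (card (A ∩ X)))
          ≡⟨ solve 2 (λ u p → u :* (con 3 :* p) := con 3 :* (u :* p)) refl (weight (A ∩ X)) (h (card (A ∩ X))) ⟩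
        3 * (weight (A ∩ X) * h (card (A ∩ X))) ∎)
    ; average = *-cancelˡ-≤ (2 ^ d) {{m^n≢0 2 d}} (begin
        2 ^ d * (sumSub (λ A → weight (A ∩ X)) * 8 ^ (D + E))
          ≡⟨ cong₂ (λ u p → 2 ^ d * (u * p)) (sumSub-cong weight-∩) (^-distribˡ-+-* 8 D E) ⟩
        2 ^ d * (sumSub (λ A → w₁ A * w₂ A) * (8 ^ D * 8 ^ E))
          ≡⟨ sym (*-assoc (2 ^ d) _ _) ⟩
        2 ^ d * sumSub (λ A → w₁ A * w₂ A) * (8 ^ D * 8 ^ E)
          ≡⟨ cong (_* (8 ^ D * 8 ^ E)) (sumSub-split split B₁.weight B₂.weight) ⟩
        sumSub w₁ * sumSub w₂ * (8 ^ D * 8 ^ E)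
          ≡⟨ solve 4 (λ u v p q → u :* v :* (p :* q) := u :* p :* (v :* q)) refl (sumSub w₁) (sumSub w₂) (8 ^ D) (8 ^ E) ⟩
        sumSub w₁ * 8 ^ D * (sumSub w₂ * 8 ^ E)
          ≤⟨ *-mono-≤ B₁.average B₂.average ⟩
        2 ^ d * (S * 7 ^ D * B₁.scale) * (2 ^ d * (T * 7 ^ E * B₂.scale))
          ≡⟨ solve 7 (λ t u p c v q e → t :* (u :* p :* c) :* (t :* (v :* q :* e)) := t :* (t :* (u :* v :* (p :* q) :* (c :* e)))) refl (2 ^ d) S (7 ^ D) B₁.scale T (7 ^ E) B₂.scale ⟩
        2 ^ d * (2 ^ d * (S * T * (7 ^ D * 7 ^ E) * (B₁.scale * B₂.scale)))
          ≡⟨ cong (λ p → 2 ^ d * (2 ^ d * (S * T * p * (B₁.scale * B₂.scale)))) (sym (^-distribˡ-+-* 7 D E)) ⟩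
        2 ^ d * (2 ^ d * (S * T * 7 ^ (D + E) * (B₁.scale * B₂.scale))) ∎)
    }
    where
    module B₁ = Bound B₁
    module B₂ = Bound B₂
    weight w₁ w₂ : Vec Bool d → ℕ
    weight A = B₁.weight (A ∩ Y) * B₂.weight (A ∩ Z)
    w₁ A = B₁.weight (A ∩ Y)
    w₂ A = B₂.weight (A ∩ Z)
    weight-∩ : ∀ A → weight (A ∩ X) ≡ w₁ A * w₂ A
    weight-∩ A = cong₂ (λ P Q → B₁.weight P * B₂.weight Q) (split-absorbˡ split A) (split-absorbˡ (split-sym split) A)

  bound-parity : ∀ g X → VarsIn g X → 0 < card X → Bound ⟦ g ⟧ X 1 1
  bound-parity g X g⊆X 0<X = record
    { rank = λ A → 2 ^ ⌊ card (A ∩ X) /2⌋ ; weight = λ B → parityWeight (odd (card B)) ; scale = 4 ; scale>0 = s≤s z≤n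
    ; rank≤ = rank-trivial g {X} g⊆X
    ; local = λ A → ≤-reflexive (2^half≡ (card (A ∩ X)))
    ; average = ≤-reflexive (begin-equality
        sumSub (λ A → parityWeight (odd (card (A ∩ X)))) * 8
          ≡⟨ solve 1 (λ u → u :* con 8 := con 2 :* u :* con 4) refl (sumSub (λ A → parityWeight (odd (card (A ∩ X))))) ⟩
        2 * sumSub (λ A → parityWeight (odd (card (A ∩ X)))) * 4
          ≡⟨ cong (_* 4) (sumSub-parity X 0<X parityWeight) ⟩
        2 ^ d * 7 * 4 ≡⟨ *-assoc (2 ^ d) 7 4 ⟩
        2 ^ d * 28 ∎) }

  -- This also covers an empty `X`, whose share is always even, so that nothing is saved.
  bound-any : ∀ g X → VarsIn g X → Bound ⟦ g ⟧ X 1 0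
  bound-any g X g⊆X = record
    { rank = λ A → 2 ^ ⌊ card (A ∩ X) /2⌋ ; weight = λ B → parityWeight (odd (card B)) ; scale = 4 ; scale>0 = s≤s z≤n
    ; rank≤ = rank-trivial g {X} g⊆X
    ; local = λ A → ≤-reflexive (2^half≡ (card (A ∩ X)))
    ; average = begin
        sumSub (λ A → parityWeight (odd (card (A ∩ X)))) * 1  ≡⟨ *-identityʳ _ ⟩
        sumSub (λ A → parityWeight (odd (card (A ∩ X))))      ≤⟨ sumSub-mono (λ A → le4 (odd (card (A ∩ X)))) ⟩
        sumSub {d} (λ A → 4)                                  ≡⟨ sumSub-const d 4 ⟩
        2 ^ d * 4                                             ∎ }
    where
    le4 : ∀ b → parityWeight b ≤ 4
    le4 true  = n≤1+n 3
    le4 false = ≤-refl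

  -- A rank that does not grow with the number of live variables loses 3/4 against `h` at each of
  -- them, on average 7/8 for each element of `X`.
  bound-rank : ∀ {Φ} s X → (∀ A → RankBound Φ A s) → Bound Φ X s (card X)
  bound-rank s X rk = record
    { rank = λ _ → s ; weight = λ B → s * pointWeight X B ; scale = 4 ^ card X ; scale>0 = m^n>0 4 (card X)
    ; rank≤ = rk
    ; local = λ A → ≤-trans (*-monoʳ-≤ s (pointWeight-h X A)) (≤-reflexive (sym (*-assoc s _ _)))
    ; average = ≤-reflexive (begin-equality
        sumSub (λ A → s * pointWeight X (A ∩ X)) * 8 ^ card X
          ≡⟨ cong (_* 8 ^ card X) (trans (sumSub-cong (λ A → *-comm s (pointWeight X (A ∩ X)))) (sumSub-*ʳ (λ A → pointWeight X (A ∩ X)) s)) ⟩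
        w * s * 8 ^ card X
          ≡⟨ solve 3 (λ u v p → u :* v :* p := v :* (u :* p)) refl w s (8 ^ card X) ⟩
        s * (w * 8 ^ card X)
          ≡⟨ cong (s *_) (pointWeight-sum X) ⟩
        s * (2 ^ d * (7 ^ card X * 4 ^ card X))
          ≡⟨ solve 4 (λ v t p q → v :* (t :* (p :* q)) := t :* (v :* p :* q)) refl s (2 ^ d) (7 ^ card X) (4 ^ card X) ⟩
        2 ^ d * (s * 7 ^ card X * 4 ^ card X) ∎) }
    where
    w = sumSub (λ A → pointWeight X (A ∩ X))

  -- A coefficient 2 for each linear form would grow exponentially over a product. Six units of
  -- saving pay for it, as (8/7)^6 ≥ 2, and the coefficient is 1 again.
  bound-rank2 : ∀ {Φ} X e → card X ≡ 6 + e → (∀ A → RankBound Φ A 2) → Bound Φ X 1 e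
  bound-rank2 X e eq rk = record { Bound B ; average = cancel-factor {s = sumSub (λ A → weight (A ∩ X))} {2 ^ d} {scale} {8 ^ 6} {7 ^ 6} {8 ^ e} {7 ^ e} (s≤s z≤n) (≤ᵇ⇒≤ (2 * 7 ^ 6) (8 ^ 6) _) avg }
    where
    B = bound-rank 2 X rk
    open Bound B
    avg : sumSub (λ A → weight (A ∩ X)) * (8 ^ 6 * 8 ^ e) ≤ 2 ^ d * (2 * (7 ^ 6 * 7 ^ e) * scale)
    avg = subst₂ (λ p q → sumSub (λ A → weight (A ∩ X)) * p ≤ 2 ^ d * (2 * q * scale))
      (trans (cong (8 ^_) eq) (^-distribˡ-+-* 8 6 e)) (trans (cong (7 ^_) eq) (^-distribˡ-+-* 7 6 e)) average

  VarsInAll : List (Formula F N) → Vec Bool d → Set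
  VarsInAll gs X = ∀ i → occs (ι i) gs ≡ true → lookup X i ≡ true

  vars : Formula F N → Vec Bool d
  vars g = tabulate (λ i → occ (ι i) g)

  lookup-vars : ∀ g i → lookup (vars g) i ≡ occ (ι i) g
  lookup-vars g i = lookup∘tabulate _ i

  inside outside : Formula F N → Vec Bool d → Vec Bool d
  inside  g X = X ∩ vars g
  outside g X = X ∩ Vec.map not (vars g)

  varsIn-head : ∀ g gs X → VarsInAll (g ∷ gs) X → VarsIn g X
  varsIn-head g gs X sub i o = sub i (occs-head {ι i} {g} {gs} o)

  varsIn-tail : ∀ g gs X → VarsInAll (g ∷ gs) X → VarsInAll gs X
  varsIn-tail g gs X sub i o = sub i (occs-tail {ι i} {g} {gs} o)

  varsIn-inside : ∀ g gs X → VarsInAll (g ∷ gs) X → VarsIn g (inside g X)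
  varsIn-inside g gs X sub i o = trans (lookup-∩ X (vars g) i)
    (cong₂ _∧_ (varsIn-head g gs X sub i o) (trans (lookup-vars g i) o))

  disjoint-any : ∀ {v g} {gs : List (Formula F N)} → All (VarDisjoint F g) gs → Occurs F v g → Any (Occurs F v) gs → ⊥
  disjoint-any {v} (dis ∷ _) o (here o′)  = dis v o o′
  disjoint-any (_ ∷ dis)     o (there o′) = disjoint-any dis o o′

  varsIn-outside : ∀ g gs X → All (VarDisjoint F g) gs → VarsInAll (g ∷ gs) X → VarsInAll gs (outside g X)
  varsIn-outside g gs X dis sub i o = trans (lookup-∩ X _ i)
    (cong₂ _∧_ (varsIn-tail g gs X sub i o) (trans (lookup-map i not (vars g)) (cong not (trans (lookup-vars g i) absent))))
    where
    absent : occ (ι i) g ≡ false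
    absent with occ (ι i) g in eq
    ... | false = refl
    ... | true  = ⊥-elim (disjoint-any dis (occ⇒Occurs (ι i) g eq) (occs⇒Occurs (ι i) gs o))

  -- Up to six variables, the parity of the share saves one unit if there is any variable at all.
  -- From m = 7 on, the rank bound 2 saves m - 6 units, which is at least m / 8.
  bound-linear : ∀ {g} → SigmaPiSigma F 0 g → ∀ X → VarsIn g X → Σ ℕ λ e → card X ≤ 8 * e × Bound ⟦ g ⟧ X 1 e
  bound-linear {g} (bottom ins) X sub with card X in eq
  ... | zero = 0 , z≤n , bound-any g X sub
  ... | suc m with 7 ≤? suc m
  ...   | no ≰7  = 1 , ≤-trans (≤-pred (≰⇒> ≰7)) (≤ᵇ⇒≤ 6 8 _) , bound-parity g X sub (subst (0 <_) (sym eq) (s≤s z≤n))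
  ...   | yes 7≤ = e , (begin
      suc m         ≡⟨ 6+e ⟩
      6 + e         ≤⟨ +-monoˡ-≤ e (≤-trans (n≤1+n 6) (*-monoʳ-≤ 7 1≤e)) ⟩
      7 * e + e     ≡⟨ +-comm (7 * e) e ⟩
      8 * e         ∎) , bound-rank2 X e (trans eq 6+e) (rank-linear ins)
    where
    e = suc m ∸ 6
    6+e : suc m ≡ 6 + e
    6+e = sym (m+[n∸m]≡n (≤-trans (n≤1+n 6) 7≤))
    1≤e : 1 ≤ e
    1≤e = ∸-monoˡ-≤ 6 7≤

  bound-linears : ∀ {gs} → All (SigmaPiSigma F 0) gs → AllPairs (VarDisjoint F) gs → ∀ X → VarsInAll gs X →
    Σ ℕ λ e → card X ≤ 8 * e × Bound ⟦ gs ⟧Π X 1 e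
  -- For the variables of `X` that no factor contains: the empty product has rank 1, so each of them
  -- saves a full unit.
  bound-linears []        _ X _ = card X , m≤n*m (card X) 8 , bound-rank 1 X (λ A κ c → rank-row _)
  bound-linears {g ∷ gs} (sg ∷ sgs) (dis ∷ diss) X sub
    with bound-linear sg (inside g X) (varsIn-inside g gs X sub)
       | bound-linears sgs diss (outside g X) (varsIn-outside g gs X dis sub)
  ... | e , le , B | e′ , le′ , B′ = e + e′ ,
    (begin
      card X                                ≡⟨ split-cardX (split-∩ X (vars g)) ⟩
      card (inside g X) + card (outside g X) ≤⟨ +-mono-≤ le le′ ⟩
      8 * e + 8 * e′                        ≡⟨ sym (*-distribˡ-+ 8 e e′) ⟩
      8 * (e + e′)                          ∎) ,
    bound-* (split-∩ X (vars g)) B B′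

  -- card X ≤ parts * heaviest: the factors that own a variable of X, together with the variables
  -- of X that occur in no factor, form parts blocks, none of them larger than heaviest.
  record ProductBound (k : ℕ) (gs : List (Formula F N)) (X : Vec Bool d) : Set (a ⊔ ℓ) where
    field
      parts heaviest : ℕ
      cover     : card X ≤ parts * heaviest
      trivially : Bound ⟦ gs ⟧Π X 1 parts
      via-heaviest : ∀ D → Need k heaviest D → Bound ⟦ gs ⟧Π X (suc (sizes F gs)) ((parts ∸ 1) + D)

  mutual
    bound-sum : ∀ {k g} → SigmaPiSigma F (suc k) g → SynMultilinear F g → ∀ X → VarsIn g X →
      ∀ D → Need k (card X) D → Bound ⟦ g ⟧ X (size F g) D
    bound-sum (layer ps) (sumG ms) X sub D need = bound-weaken (n≤1+n _) ≤-refl (bound-products ps ms X sub D need)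

    bound-products : ∀ {k gs} → All (PiLayer F k) gs → All (SynMultilinear F) gs → ∀ X → VarsInAll gs X →
      ∀ D → Need k (card X) D → Bound ⟦ gs ⟧Σ X (sizes F gs) D
    bound-products []       _        X sub D need = bound-0 (λ A κ c → [] , z≤n , λ x y → Field.refl F)
    bound-products {gs = g ∷ gs} (p ∷ ps) (m ∷ ms) X sub D need =
      bound-+ (bound-product p m X (varsIn-head g gs X sub) D need)
              (bound-products ps ms X (varsIn-tail g gs X sub) D need)

    bound-product : ∀ {k g} → PiLayer F k g → SynMultilinear F g → ∀ X → VarsIn g X →
      ∀ D → Need k (card X) D → Bound ⟦ g ⟧ X (size F g) D
    bound-product {zero} (prodG ss) (prodG ms dis) X sub D need with bound-linears ss dis X sub
    ... | e , le , B = bound-weaken (s≤s z≤n) (need e le) B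
    bound-product {suc k} (prodG ss) (prodG ms dis) X sub D need =
      -- The parts save `parts ∸ 1`, and `Need` guarantees the remainder of `D` inside the heaviest
      -- one.
      bound-weaken ≤-refl (m≤n+m∸n D (P.parts ∸ 1)) (P.via-heaviest _ (need P.parts P.heaviest P.cover))
      where module P = ProductBound (bound-factors ss ms dis X sub)

    -- The recursion remembers the heaviest block among the later factors. A new factor either is
    -- one more part, saving a unit by parity, or becomes the one to be opened; in the latter case
    -- the later blocks fall back on `trivially`, so both bounds are carried along.
    bound-factors : ∀ {k gs} → All (SigmaPiSigma F (suc k)) gs → All (SynMultilinear F) gs → AllPairs (VarDisjoint F) gs →
      ∀ X → VarsInAll gs X → ProductBound k gs X
    bound-factors {k} [] _ _ X sub = record
      -- Every variable outside all factors is a block of its own, so blocks have size at most 1.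
      -- Then `need⇒≤` gives D ≤ 1, and the rank-one bound already saves that much.
      { parts = card X ; heaviest = card X ⊓ 1
      ; cover = cover (card X)
      ; trivially = B
      ; via-heaviest = λ D need → bound-weaken ≤-refl (enough (card X) (need⇒≤ k _ D need)) B }
      where
      B : Bound ⟦ [] ⟧Π X 1 (card X)
      B = bound-rank 1 X (λ A κ c → rank-row _)
      cover : ∀ n → n ≤ n * (n ⊓ 1)
      cover zero    = z≤n
      cover (suc n) = ≤-reflexive (sym (trans (cong (λ z → suc n * suc z) (⊓-zeroʳ n)) (*-identityʳ (suc n))))
      enough : ∀ n {D} → D ≤ n ⊓ 1 → n ∸ 1 + D ≤ n
      enough zero    D≤ = D≤
      enough (suc n) D≤ = ≤-trans (+-monoʳ-≤ n (≤-trans D≤ (m⊓n≤n (suc n) 1))) (≤-reflexive (+-comm n 1))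
    bound-factors {k} {g ∷ gs} (s ∷ ss) (m ∷ ms) (dis ∷ diss) X sub
      with bound-factors ss ms diss (outside g X) (varsIn-outside g gs X dis sub) | card (inside g X) in eq
    ... | P | zero = record
      { parts = P.parts ; heaviest = P.heaviest
      ; cover = ≤-trans (≤-reflexive (trans (split-cardX (split-∩ X (vars g))) (cong (_+ card (outside g X)) eq))) P.cover
      ; trivially = bound-* split (bound-any g (inside g X) g⊆) P.trivially
      ; via-heaviest = λ D need → bound-weaken size-tail ≤-refl (bound-* split (bound-any g (inside g X) g⊆) (P.via-heaviest D need)) }
      where
      module P = ProductBound P
      split = split-∩ X (vars g)
      g⊆ = varsIn-inside g gs X sub
      size-tail : 1 * suc (sizes F gs) ≤ suc (size F g + sizes F gs)
      size-tail = ≤-trans (≤-reflexive (*-identityˡ (suc (sizes F gs)))) (s≤s (m≤n+m _ _))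
    ... | P | suc n with ≤-total (suc n) (ProductBound.heaviest P)
    ...   | inj₁ lighter = record
      { parts = suc P.parts ; heaviest = P.heaviest
      ; cover = ≤-trans (≤-reflexive (trans (split-cardX split) (cong (_+ card (outside g X)) eq))) (+-mono-≤ lighter P.cover)
      ; trivially = bound-* split alone P.trivially
      ; via-heaviest = λ D need → bound-weaken size-tail (enough P.parts D) (bound-* split alone (P.via-heaviest D need)) }
      where
      module P = ProductBound P
      split = split-∩ X (vars g)
      alone = bound-parity g (inside g X) (varsIn-inside g gs X sub) (subst (0 <_) (sym eq) (s≤s z≤n))
      size-tail : 1 * suc (sizes F gs) ≤ suc (size F g + sizes F gs)
      size-tail = ≤-trans (≤-reflexive (*-identityˡ (suc (sizes F gs)))) (s≤s (m≤n+m _ _))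
      enough : ∀ p D → p + D ≤ suc (p ∸ 1 + D)
      enough zero    D = n≤1+n D
      enough (suc p) D = ≤-refl
    ...   | inj₂ heavier = record
      { parts = suc P.parts ; heaviest = suc n
      ; cover = ≤-trans (≤-reflexive (trans (split-cardX split) (cong (_+ card (outside g X)) eq)))
                        (+-monoʳ-≤ (suc n) (≤-trans P.cover (*-monoʳ-≤ P.parts heavier)))
      ; trivially = bound-* split alone P.trivially
      -- Only the opened factor contributes its size; the rest enters with coefficient 1, so sizes
      -- are never multiplied.
      ; via-heaviest = λ D need → bound-weaken size-head (≤-reflexive (+-comm P.parts D))
          (bound-* split (bound-sum s m (inside g X) (varsIn-inside g gs X sub) D (subst (λ z → Need k z D) (sym eq) need)) P.trivially) }
      where
      module P = ProductBound P
      split = split-∩ X (vars g)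
      alone = bound-parity g (inside g X) (varsIn-inside g gs X sub) (subst (0 <_) (sym eq) (s≤s z≤n))
      size-head : size F g * 1 ≤ suc (size F g + sizes F gs)
      size-head = ≤-trans (≤-reflexive (*-identityʳ (size F g))) (≤-trans (m≤m+n _ _) (n≤1+n _))

-- Lower bounds on rank from independent columns.

module Kernel {a ℓ : Level} (F : Field a ℓ) where
  open Field F hiding (zero)
  open Rank F
  open import Relation.Binary.Reasoning.Setoid setoid
  open import Algebra.Properties.Semiring.Sum semiring using (sum; sum-cong-≋; sum-remove; ∑-distrib-+; *-distribˡ-sum; sum-replicate-zero)
  open import Algebra.Properties.Ring ring using (-‿distribˡ-*)
  open import Algebra.Solver.Ring.NaturalCoefficients.Default commutativeSemiring using (solve; _:+_; _:*_; _:=_; con)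

  sum-cong : ∀ {n} (f g : Fin n → Carrier) → (∀ i → f i ≈ g i) → sum f ≈ sum g
  sum-cong f g eq = sum-cong-≋ {x = f} {g} eq

  sum-0 : ∀ {n} (f : Fin n → Carrier) → (∀ i → f i ≈ 0#) → sum f ≈ 0#
  sum-0 {n} f z = trans (sum-cong f (λ _ → 0#) z) (sum-replicate-zero n)

  sum-linear : ∀ {n} (w u v : Fin n → Carrier) k →
    sum (λ i → w i * (u i + k * v i)) ≈ sum (λ i → w i * u i) + k * sum (λ i → w i * v i)
  sum-linear w u v k = begin
    sum (λ i → w i * (u i + k * v i))
      ≈⟨ sum-cong (λ i → w i * (u i + k * v i)) (λ i → w i * u i + k * (w i * v i)) (λ i → solve 4 (λ w u v k → w :* (u :+ k :* v) := w :* u :+ k :* (w :* v)) refl (w i) (u i) (v i) k) ⟩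
    sum (λ i → w i * u i + k * (w i * v i))
      ≈⟨ ∑-distrib-+ (λ i → w i * u i) (λ i → k * (w i * v i)) ⟩
    sum (λ i → w i * u i) + sum (λ i → k * (w i * v i))
      ≈⟨ +-congˡ (sym (*-distribˡ-sum k (λ i → w i * v i))) ⟩
    sum (λ i → w i * u i) + k * sum (λ i → w i * v i) ∎

  -- Equality in F need not be decidable, so the search for a pivot happens under a double negation.
  ¬¬-pivot : ∀ {n} (b : Fin n → Carrier) → ¬ ¬ ((Σ (Fin n) λ i → ¬ (b i ≈ 0#)) ⊎ (∀ i → b i ≈ 0#))
  ¬¬-pivot {zero}  b k = k (inj₂ λ ())
  ¬¬-pivot {suc n} b k = ¬¬-excluded-middle λ where
    (no b₀≉0)  → k (inj₁ (zero , b₀≉0))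
    (yes b₀≈0) → ¬¬-pivot (b ∘ suc) λ where
      (inj₁ (i , bᵢ≉0)) → k (inj₁ (suc i , bᵢ≉0))
      (inj₂ b≈0)        → k (inj₂ λ { zero → b₀≈0 ; (suc i) → b≈0 i })

  Annihilates : ∀ {n} → (Fin n → Carrier) → (Fin n → Carrier) → Set ℓ
  Annihilates w b = sum (λ i → w i * b i) ≈ 0#

  NontrivialKernel : ∀ {n} → List (Fin n → Carrier) → Set (a ⊔ ℓ)
  NontrivialKernel {n} bs = Σ (Fin n → Carrier) λ w → (Σ (Fin n) λ i → ¬ (w i ≈ 0#)) × All (Annihilates w) bs

  -- Gaussian elimination: with a pivot in `b`, the other vectors are cleared at that coordinate and
  -- lose it, so their number and the dimension drop together and r < n persists. A zero vector `b`
  -- is dropped outright.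
  ¬¬-kernel : ∀ {n} r (bs : List (Fin n → Carrier)) → length bs ≡ r → r ℕ.< n → ¬ ¬ NontrivialKernel bs
  ¬¬-kernel {suc n} _       []       _   _         k = k ((λ _ → 1#) , (zero , 1≉0) , [])
  ¬¬-kernel {suc n} (suc r) (b ∷ bs) len (s≤s r<n) k = ¬¬-pivot b λ where
      (inj₂ b≈0) → ¬¬-kernel r bs (ℕₚ.suc-injective len) (ℕₚ.m≤n⇒m≤1+n r<n) λ (w , w≉0 , ker) →
        k (w , w≉0 , sum-0 (λ i → w i * b i) (λ i → trans (*-congˡ (b≈0 i)) (zeroʳ (w i))) ∷ ker)
      (inj₁ (p , bₚ≉0)) → eliminate p bₚ≉0
    where
    eliminate : ∀ p → ¬ ¬ (b p ≈ 0#)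
    eliminate p bₚ≉0 = ¬¬-kernel r (List.map reduce bs) (≡.trans (length-map reduce bs) (ℕₚ.suc-injective len)) r<n extend
      where
      q m : Carrier
      q = proj₁ (inverse (b p) bₚ≉0)
      -- Since m = -1 / b p, adding m · c p · b clears coordinate `p` of `c`; the value `v` below
      -- makes the extended vector annihilate `b`.
      m = - q
      reduce : (Fin (suc n) → Carrier) → Fin n → Carrier
      reduce c j = c (punchIn p j) + m * c p * b (punchIn p j)
      m*b+1≈0 : m * b p + 1# ≈ 0#
      m*b+1≈0 = begin
        m * b p + 1#       ≈⟨ +-cong (sym (-‿distribˡ-* q (b p))) (sym (proj₂ (inverse (b p) bₚ≉0))) ⟩
        - (q * b p) + b p * q ≈⟨ +-congˡ (*-comm (b p) q) ⟩
        - (q * b p) + q * b p ≈⟨ -‿inverseˡ (q * b p) ⟩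
        0#                 ∎
      extend : ¬ NontrivialKernel (List.map reduce bs)
      extend (w , (i , wᵢ≉0) , ker) = k (w⁺ , (punchIn p i , λ w⁺≈0 → wᵢ≉0 (trans (sym (reflexive (insertAt-punchIn w p v i))) w⁺≈0)) , pivot ∷ All.map (λ {c} → rest c) (map⁻ ker))
        where
        B v : Carrier
        B = sum (λ j → w j * b (punchIn p j))
        v = m * B
        w⁺ : Fin (suc n) → Carrier
        w⁺ = insertAt w p v
        expand : ∀ c → sum (λ j → w⁺ j * c j) ≈ v * c p + sum (λ j → w j * c (punchIn p j))
        expand c = trans (sum-remove {i = p} (λ j → w⁺ j * c j))
          (+-cong (*-congʳ (reflexive (insertAt-lookup w p v)))
                  (sum-cong (λ j → w⁺ (punchIn p j) * c (punchIn p j)) (λ j → w j * c (punchIn p j)) (λ j → *-congʳ (reflexive (insertAt-punchIn w p v j)))))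
        pivot : Annihilates w⁺ b
        pivot = begin
          sum (λ j → w⁺ j * b j)  ≈⟨ expand b ⟩
          m * B * b p + B         ≈⟨ solve 3 (λ m B c → m :* B :* c :+ B := (m :* c :+ con 1) :* B) refl m B (b p) ⟩
          (m * b p + 1#) * B      ≈⟨ *-congʳ m*b+1≈0 ⟩
          0# * B                  ≈⟨ zeroˡ B ⟩
          0#                      ∎
        rest : ∀ c → Annihilates w (reduce c) → Annihilates w⁺ c
        rest c ann = begin
          sum (λ j → w⁺ j * c j)              ≈⟨ expand c ⟩
          m * B * c p + C                     ≈⟨ solve 4 (λ m B c C → m :* B :* c :+ C := C :+ m :* c :* B) refl m B (c p) C ⟩
          C + m * c p * B                     ≈⟨ sym (sum-linear w (c ∘ punchIn p) (b ∘ punchIn p) (m * c p)) ⟩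
          sum (λ j → w j * reduce c j)        ≈⟨ ann ⟩
          0#                                  ∎
          where C = sum (λ j → w j * c (punchIn p j))

  sumDyads-annihilate : ∀ {R C n} (l : Dyads R C) (y : Fin n → C) w →
    All (Annihilates w) (List.map (λ (_ , v) → v ∘ y) l) → ∀ x → sum (λ i → w i * sumDyads l x (y i)) ≈ 0#
  sumDyads-annihilate []            y w _           x = sum-0 (λ i → w i * 0#) (λ i → zeroʳ (w i))
  sumDyads-annihilate ((u , v) ∷ l) y w (ann ∷ ker) x = begin
    sum (λ i → w i * (u x * v (y i) + sumDyads l x (y i)))
      ≈⟨ sum-cong (λ i → w i * (u x * v (y i) + sumDyads l x (y i))) (λ i → w i * (sumDyads l x (y i) + u x * v (y i))) (λ i → *-congˡ (+-comm _ _)) ⟩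
    sum (λ i → w i * (sumDyads l x (y i) + u x * v (y i)))
      ≈⟨ sum-linear w (λ i → sumDyads l x (y i)) (v ∘ y) (u x) ⟩
    sum (λ i → w i * sumDyads l x (y i)) + u x * sum (λ i → w i * v (y i))
      ≈⟨ +-cong (sumDyads-annihilate l y w ker x) (trans (*-congˡ ann) (zeroʳ (u x))) ⟩
    0# + 0#
      ≈⟨ +-identityˡ 0# ⟩
    0# ∎

  -- If r < n, the right factors of the dyads, read at the n columns, have a common non-zero
  -- annihilator, which contradicts independence. It exists only under a double negation, and this
  -- is enough because n ≤ r is decidable.
  independent-columns⇒≤rank : ∀ {R C n r} {φ : R → C → Carrier} (y : Fin n → C) →
    (∀ w → (∀ x → sum (λ i → w i * φ x (y i)) ≈ 0#) → ∀ i → w i ≈ 0#) → RankLe φ r → n ℕ.≤ r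
  independent-columns⇒≤rank {n = n} {r} {φ} y independent (l , len , φ≈) with n ℕ.≤? r
  ... | yes n≤r = n≤r
  ... | no n≰r  = contradiction refute
      (¬¬-kernel (length l) (List.map (λ (_ , v) → v ∘ y) l) (length-map _ l) (ℕₚ.≤-<-trans len (ℕₚ.≰⇒> n≰r)))
    where
    refute : ¬ NontrivialKernel (List.map (λ (_ , v) → v ∘ y) l)
    refute (w , (i , wᵢ≉0) , ker) = wᵢ≉0 (independent w
      (λ x → trans (sum-cong (λ j → w j * φ x (y j)) (λ j → w j * sumDyads l x (y j)) (λ j → *-congˡ (φ≈ x (y j)))) (sumDyads-annihilate l y w ker x)) i)

-- Full rank of the restricted matrix product.

module LowerBound {a ℓ : Level} (F : Field a ℓ) where
  open Field F hiding (zero)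
  open Evaluation F
  open Rank F
  open Kernel F
  open import Relation.Binary.Reasoning.Setoid setoid
  open import Algebra.Properties.Semiring.Sum semiring using (sum; ∑-distrib-+)
  open import Algebra.Solver.Ring.NaturalCoefficients.Default commutativeSemiring using (solve; _:+_; _:*_; _:=_; con)

  pattern 0F = zero
  pattern 1F = suc zero

  Matrix : Set a
  Matrix = Fin 2 → Fin 2 → Carrier

  -- The product M₁⋯Mₘ applied to the column vector (1, 1).
  chain : ∀ {m} → (Fin m → Matrix) → Fin 2 → Carrier
  chain {zero}  M j = 1#
  chain {suc m} M j = M zero j 0F * chain (M ∘ suc) 0F + M zero j 1F * chain (M ∘ suc) 1F

  entries : ∀ d → (Fin (d ℕ.* 4) → Carrier) → Fin d → Matrix
  entries d σ i j k = σ (combine {d} {4} i (combine {2} {2} j k))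

  eval-prodMats : ∀ d {m} (σ : Fin (d ℕ.* 4) → Carrier) (g : Fin m → Fin d) j →
    eval (prodMats F (List.tabulate g) j 0F) σ + eval (prodMats F (List.tabulate g) j 1F) σ ≈
    chain (λ i → entries d σ (g i)) j
  eval-prodMats d {zero}  σ g 0F = +-identityʳ 1#
  eval-prodMats d {zero}  σ g 1F = +-identityˡ 1#
  eval-prodMats d {suc m} σ g j  = trans
    (solve 6 (λ p q u v s t → (p :* (u :* con 1) :+ (q :* (v :* con 1) :+ con 0)) :+ (p :* (s :* con 1) :+ (q :* (t :* con 1) :+ con 0))
                := p :* (u :+ s) :+ q :* (v :+ t)) refl
       (entries d σ (g zero) j 0F) (entries d σ (g zero) j 1F)
       (rest 0F 0F) (rest 1F 0F) (rest 0F 1F) (rest 1F 1F))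
    (+-cong (*-congˡ (eval-prodMats d σ (g ∘ suc) 0F)) (*-congˡ (eval-prodMats d σ (g ∘ suc) 1F)))
    where
    rest : Fin 2 → Fin 2 → Carrier
    rest j k = eval (prodMats F (List.tabulate (g ∘ suc)) j k) σ

  eval-IMM : ∀ d (σ : Fin (d ℕ.* 4) → Carrier) → eval (IMM F d) σ ≈ chain (entries d σ) 0F
  eval-IMM d σ = trans (+-congˡ (+-identityʳ _)) (eval-prodMats d σ (λ i → i) 0F)

  -- Alive matrices alternately open a pair, [u 1; 1 0], and close it, [u 0; 1 0]; all others are
  -- the identity.  An adjacent pair with entries y, z contributes the factor 1 + yz.
  gate : Bool → Bool → Carrier → Matrix
  gate false _    u 0F 0F = 1#
  gate false _    u 0F 1F = 0#
  gate false _    u 1F 0F = 0#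
  gate false _    u 1F 1F = 1#
  gate true  _    u 0F 0F = u
  gate true  opn  u 0F 1F = if opn then 0# else 1#
  gate true  _    u 1F 0F = 1#
  gate true  _    u 1F 1F = 0#

  next : Bool → Bool → Bool
  next alive opn = if alive then not opn else opn

  open? : ∀ {m} → Vec Bool m → Bool → Fin m → Bool
  open? (alive ∷ A) opn zero    = opn
  open? (alive ∷ A) opn (suc i) = open? A (next alive opn) i

  value : ∀ {m} → Vec Bool m → Bool → Vec Bool m → Vec Bool m → Fin 2 → Carrier
  value []          opn []      []      j = 1#
  value (alive ∷ A) opn (x ∷ xs) (y ∷ ys) j =
    gate alive opn u j 0F * value A (next alive opn) xs ys 0F + gate alive opn u j 1F * value A (next alive opn) xs ys 1F
    where u = bit (if opn then y else x)

  chain-value : ∀ {m} (M : Fin m → Matrix) (A : Vec Bool m) opn x y →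
    (∀ i j k → M i j k ≈ gate (lookup A i) (open? A opn i) (bit (if open? A opn i then lookup y i else lookup x i)) j k) →
    ∀ j → chain M j ≈ value A opn x y j
  chain-value M []          opn []       []       eq j = refl
  chain-value M (alive ∷ A) opn (x ∷ xs) (y ∷ ys) eq j =
    +-cong (*-cong (eq zero j 0F) (tl 0F)) (*-cong (eq zero j 1F) (tl 1F))
    where tl = chain-value (M ∘ suc) A (next alive opn) xs ys (λ i → eq (suc i))

  columns : ∀ {m} → Vec Bool m → Bool → ℕ
  columns []          opn   = 1
  columns (false ∷ A) opn   = columns A opn
  columns (true  ∷ A) false = columns A true
  columns (true  ∷ A) true  = columns A false ℕ.+ columns A false

  -- The columns vary only where an alive matrix closes a pair, since only there is `y` read; all
  -- other bits are `false`.
  column : ∀ {m} (A : Vec Bool m) opn → Fin (columns A opn) → Vec Bool m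
  column []          opn   _ = []
  column (false ∷ A) opn   i = false ∷ column A opn i
  column (true  ∷ A) false i = false ∷ column A true i
  column (true  ∷ A) true  i = [ (λ j → false ∷ column A false j) , (λ j → true ∷ column A false j) ]′ (splitAt (columns A false) i)

  columns≡ : ∀ {m} (A : Vec Bool m) opn → columns A opn ≡ 2 ℕ.^ ⌊ (if opn then suc (card A) else card A) /2⌋
  columns≡ []          true  = ≡.refl
  columns≡ []          false = ≡.refl
  columns≡ (false ∷ A) true  = columns≡ A true
  columns≡ (false ∷ A) false = columns≡ A false
  columns≡ (true  ∷ A) false = columns≡ A true
  columns≡ (true  ∷ A) true  = ≡.trans (≡.cong₂ ℕ._+_ (columns≡ A false) (columns≡ A false)) (≡.sym (2^suc ⌊ card A /2⌋))

  -- While a pair is open, its first entry t has already been read.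
  readout : Bool → Bool → (Fin 2 → Carrier) → Carrier
  readout false t v = v 0F
  readout true  t v = bit t * v 0F + v 1F

  sum-splitAt : ∀ m n (f : Fin (m ℕ.+ n) → Carrier) → sum f ≈ sum (λ i → f (i ↑ˡ n)) + sum (λ i → f (m ↑ʳ i))
  sum-splitAt zero    n f = sym (+-identityˡ _)
  sum-splitAt (suc m) n f = trans (+-congˡ (sum-splitAt m n (f ∘ suc))) (sym (+-assoc _ _ _))

  -- A closing matrix completes a factor 1 + t z with row bit t and column bit z. As a matrix in t
  -- and z this is invertible over every field, so independence for the rest of the chain yields
  -- independence of both halves of the columns.
  columns-independent : ∀ {m} (A : Vec Bool m) opn (w : Fin (columns A opn) → Carrier) →
    (∀ x t → sum (λ i → w i * readout opn t (value A opn x (column A opn i))) ≈ 0#) → ∀ i → w i ≈ 0#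
  columns-independent [] false w eq zero = trans (solve 1 (λ u → u := u :* con 1 :+ con 0) refl (w zero)) (eq [] false)
  -- The value t = `false` leaves the factor 1; t = `true` would leave 1 + 1, which may vanish.
  columns-independent [] true  w eq zero = trans (solve 1 (λ u → u := u :* (con 0 :* con 1 :+ con 1) :+ con 0) refl (w zero)) (eq [] false)
  columns-independent (false ∷ A) false w eq = columns-independent A false w (λ x t → trans
    (sum-cong (λ i → w i * value A false x (column A false i) 0F) (λ i → w i * value (false ∷ A) false (false ∷ x) (false ∷ column A false i) 0F)
      (λ i → solve 3 (λ w u v → w :* u := w :* (con 1 :* u :+ con 0 :* v)) refl (w i) _ (value A false x (column A false i) 1F)))
    (eq (false ∷ x) t))
  columns-independent (false ∷ A) true w eq = columns-independent A true w (λ x t → trans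
    (sum-cong (λ i → w i * readout true t (value A true x (column A true i))) (λ i → w i * readout true t (value (false ∷ A) true (false ∷ x) (false ∷ column A true i)))
      (λ i → solve 4 (λ w t u v → w :* (t :* u :+ v) := w :* (t :* (con 1 :* u :+ con 0 :* v) :+ (con 0 :* u :+ con 1 :* v))) refl
        (w i) (bit t) (value A true x (column A true i) 0F) (value A true x (column A true i) 1F)))
    (eq (false ∷ x) t))
  columns-independent (true ∷ A) false w eq = columns-independent A true w (λ x t → trans
    (sum-cong (λ i → w i * readout true t (value A true x (column A true i))) (λ i → w i * value (true ∷ A) false (t ∷ x) (false ∷ column A true i) 0F)
      (λ i → solve 4 (λ w t u v → w :* (t :* u :+ v) := w :* (t :* u :+ con 1 :* v)) refl
        (w i) (bit t) (value A true x (column A true i) 0F) (value A true x (column A true i) 1F)))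
    (eq (t ∷ x) t))
  columns-independent (true ∷ A) true w eq i = ≡.subst (λ i → w i ≈ 0#) (join-splitAt n n i) (vanish (splitAt n i))
    where
    n = columns A false
    w₀ w₁ : Fin n → Carrier
    w₀ i = w (i ↑ˡ n)
    w₁ i = w (n ↑ʳ i)
    V : Vec Bool _ → Fin n → Fin 2 → Carrier
    V x i = value A false x (column A false i)
    -- The two halves merge into w₀ + w₁ for t = `false` and w₀ + 2 w₁ for t = `true`. Both vanish,
    -- and their difference is w₁.
    combined : Bool → Fin n → Carrier
    combined t i = w₀ i + (bit t + 1#) * w₁ i
    term : Bool → Vec Bool _ → Fin (n ℕ.+ n) → Carrier
    term t x i = w i * readout true t (value (true ∷ A) true (false ∷ x) (column (true ∷ A) true i))
    low : ∀ t x i → term t x (i ↑ˡ n) ≈ w₀ i * V x i 0F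
    low t x i rewrite splitAt-↑ˡ n i n =
      solve 4 (λ w t u v → w :* (t :* (con 0 :* u :+ con 0 :* v) :+ (con 1 :* u :+ con 0 :* v)) := w :* u) refl (w₀ i) (bit t) (V x i 0F) (V x i 1F)
    high : ∀ t x i → term t x (n ↑ʳ i) ≈ (bit t + 1#) * w₁ i * V x i 0F
    high t x i rewrite splitAt-↑ʳ n n i =
      solve 4 (λ w t u v → w :* (t :* (con 1 :* u :+ con 0 :* v) :+ (con 1 :* u :+ con 0 :* v)) := (t :+ con 1) :* w :* u) refl (w₁ i) (bit t) (V x i 0F) (V x i 1F)
    combined≈0 : ∀ t i → combined t i ≈ 0#
    combined≈0 t = columns-independent A false (combined t) (λ x _ → begin
      sum (λ i → combined t i * V x i 0F)
        ≈⟨ sum-cong (λ i → combined t i * V x i 0F) (λ i → term t x (i ↑ˡ n) + term t x (n ↑ʳ i))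
             (λ i → trans (distribʳ _ _ _) (sym (+-cong (low t x i) (high t x i)))) ⟩
      sum (λ i → term t x (i ↑ˡ n) + term t x (n ↑ʳ i))
        ≈⟨ ∑-distrib-+ (λ i → term t x (i ↑ˡ n)) (λ i → term t x (n ↑ʳ i)) ⟩
      sum (λ i → term t x (i ↑ˡ n)) + sum (λ i → term t x (n ↑ʳ i))
        ≈⟨ sym (sum-splitAt n n (term t x)) ⟩
      sum (term t x)
        ≈⟨ eq (false ∷ x) t ⟩
      0# ∎)
    w₁≈0 : ∀ i → w₁ i ≈ 0#
    w₁≈0 i = begin
      w₁ i                    ≈⟨ sym (+-identityˡ _) ⟩
      0# + w₁ i               ≈⟨ +-congʳ (sym (combined≈0 false i)) ⟩
      combined false i + w₁ i ≈⟨ solve 2 (λ u v → (u :+ (con 0 :+ con 1) :* v) :+ v := u :+ (con 1 :+ con 1) :* v) refl (w₀ i) (w₁ i) ⟩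
      combined true i         ≈⟨ combined≈0 true i ⟩
      0#                      ∎
    w₀≈0 : ∀ i → w₀ i ≈ 0#
    w₀≈0 i = begin
      w₀ i                     ≈⟨ sym (+-identityʳ _) ⟩
      w₀ i + 0#                ≈⟨ +-congˡ (sym (trans (*-congˡ (w₁≈0 i)) (zeroʳ _))) ⟩
      combined false i         ≈⟨ combined≈0 false i ⟩
      0#                       ∎
    vanish : ∀ s → w ([ (_↑ˡ n) , (n ↑ʳ_) ]′ s) ≈ 0#
    vanish (inj₁ j) = w₀≈0 j
    vanish (inj₂ j) = w₁≈0 j

  module _ (d : ℕ) where
    ι : Fin d → Fin (d ℕ.* 4)
    ι i = combine i zero

    corner : Fin d × Fin 4 → Maybe (Fin d)
    corner (i , zero)  = just i
    corner (i , suc _) = nothing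

    main : Fin (d ℕ.* 4) → Maybe (Fin d)
    main v = corner (remQuot {d} 4 v)

    main-ι : ∀ {v i} → main v ≡ just i → v ≡ ι i
    main-ι {v} {i} eq = ≡.trans (≡.sym (combine-remQuot {d} 4 v)) (from-corner (remQuot {d} 4 v) eq)
      where
      from-corner : ∀ p → corner p ≡ just i → uncurry combine p ≡ ι i
      from-corner (_ , zero) ≡.refl = ≡.refl

    open Restriction F ι main main-ι

    module _ (A : Vec Bool d) where
      -- Opening variables become rows and closing ones columns, so that every factor 1 + yz
      -- straddles the split.
      rows : Vec Bool d
      rows = tabulate (λ i → not (open? A false i))

      -- Here `0#` is a placeholder at the corner of an alive matrix, where `choose` puts the row or
      -- column bit.
      constantAt : Fin d × Fin 4 → Carrier
      constantAt (i , jk) = uncurry (gate (lookup A i) (open? A false i) 0#) (remQuot 2 jk)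

      constants : Fin (d ℕ.* 4) → Carrier
      constants v = constantAt (remQuot {d} 4 v)

      point-gate : ∀ x y i j k → entries d (point A rows constants x y) i j k ≈
        gate (lookup A i) (open? A false i) (bit (if open? A false i then lookup y i else lookup x i)) j k
      point-gate x y i j k = trans
        (reflexive (≡.cong (λ p → choose A rows x y (corner p) (constantAt p)) (remQuot-combine i (combine j k)))) (entry j k)
        where
        rowBit : (if lookup rows i then lookup x i else lookup y i) ≡ (if open? A false i then lookup y i else lookup x i)
        rowBit rewrite lookup∘tabulate (λ i → not (open? A false i)) i with open? A false i
        ... | true  = ≡.refl
        ... | false = ≡.refl
        entry : ∀ j k → choose A rows x y (corner (i , combine j k)) (constantAt (i , combine j k)) ≈
          gate (lookup A i) (open? A false i) (bit (if open? A false i then lookup y i else lookup x i)) j k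
        entry 0F 0F with lookup A i
        ... | true  = reflexive (≡.cong bit rowBit)
        ... | false = refl
        entry 0F 1F with lookup A i
        ... | true  = refl
        ... | false = refl
        entry 1F 0F with lookup A i
        ... | true  = refl
        ... | false = refl
        entry 1F 1F with lookup A i
        ... | true  = refl
        ... | false = refl

      rank-IMM : ∀ {f r} → Computes F f (IMM F d) → RankBound ⟦ f ⟧ A r → 2 ℕ.^ ⌊ card A /2⌋ ℕ.≤ r
      rank-IMM {f} {r} computes rank = ≡.subst (ℕ._≤ r) (columns≡ A false)
        (independent-columns⇒≤rank (column A false)
          (λ w eq → columns-independent A false w (λ x _ → eq x))
          (rank-cong (λ x y → sym (restricted x y)) (rank rows constants)))
        where
        restricted : ∀ x y → eval f (point A rows constants x y) ≈ value A false x y 0F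
        restricted x y = trans (samePoly⇒eval≈ f (IMM F d) computes _)
          (trans (eval-IMM d (point A rows constants x y)) (chain-value _ A false x y (point-gate x y) 0F))

-- Comparison of the two bounds.

module Main {a ℓ : Level} (F : Field a ℓ) (d : ℕ) where
  open import Data.Nat hiding (_⊔_)
  open ℕₚ
  open ≡
  open ≤-Reasoning
  open +-*-Solver using (solve; _:+_; _:*_; _:=_; con)
  open LowerBound F
  open UpperBound F (ι d) (main d) (main-ι d)

  everything : Vec Bool d
  everything = replicate d true

  card-everything : ∀ n → card (replicate n true) ≡ n
  card-everything zero    = refl
  card-everything (suc n) = cong suc (card-everything n)

  ∩-everything : ∀ {n} (A : Vec Bool n) → A ∩ replicate n true ≡ A
  ∩-everything []          = refl
  ∩-everything (true  ∷ A) = cong (true ∷_) (∩-everything A)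
  ∩-everything (false ∷ A) = cong (false ∷_) (∩-everything A)

  -- For every `A` the relative rank is at least 3/4, the value reached when the number of live
  -- variables is odd, while its mean is at most the size times (7/8)^D.
  size-bound : ∀ {k f} → SynMultilinear F f → SigmaPiSigma F (suc k) f → Computes F f (IMM F d) →
    ∀ D → Need k d D → 3 * 8 ^ D ≤ 4 * (size F f * 7 ^ D)
  size-bound {k} {f} ml sps computes D need =
    *-cancelˡ-≤ (2 ^ d * scale) {{m*n≢0 (2 ^ d) scale {{m^n≢0 2 d}} {{>-nonZero scale>0}}}} (begin
      2 ^ d * scale * (3 * 8 ^ D)
        ≡⟨ solve 3 (λ t c p → t :* c :* (con 3 :* p) := t :* (con 3 :* c) :* p) refl (2 ^ d) scale (8 ^ D) ⟩
      2 ^ d * (3 * scale) * 8 ^ D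
        ≡⟨ cong (_* 8 ^ D) (sym (sumSub-const d (3 * scale))) ⟩
      sumSub {d} (λ _ → 3 * scale) * 8 ^ D
        ≤⟨ *-monoˡ-≤ (8 ^ D) (sumSub-mono heavy) ⟩
      sumSub (λ A → w A * 4) * 8 ^ D
        ≡⟨ cong (_* 8 ^ D) (sumSub-*ʳ w 4) ⟩
      sumSub w * 4 * 8 ^ D
        ≡⟨ solve 2 (λ u p → u :* con 4 :* p := con 4 :* (u :* p)) refl (sumSub w) (8 ^ D) ⟩
      4 * (sumSub w * 8 ^ D)
        ≤⟨ *-monoʳ-≤ 4 average ⟩
      4 * (2 ^ d * (size F f * 7 ^ D * scale))
        ≡⟨ solve 4 (λ t s p c → con 4 :* (t :* (s :* p :* c)) := t :* c :* (con 4 :* (s :* p))) refl (2 ^ d) (size F f) (7 ^ D) scale ⟩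
      2 ^ d * scale * (4 * (size F f * 7 ^ D)) ∎)
    where
    open Bound (bound-sum sps ml everything (λ i _ → lookup-replicate i true) D
      (subst (λ n → Need k n D) (sym (card-everything d)) need))
    w : Vec Bool d → ℕ
    w A = weight (A ∩ everything)
    heavy : ∀ A → 3 * scale ≤ w A * 4
    heavy A = *-cancelˡ-≤ (2 ^ ⌊ card A /2⌋) {{m^n≢0 2 ⌊ card A /2⌋}} (begin
      2 ^ ⌊ card A /2⌋ * (3 * scale)
        ≤⟨ *-monoˡ-≤ (3 * scale) (rank-IMM d A {f} computes (rank≤ A)) ⟩
      rank A * (3 * scale)
        ≤⟨ local A ⟩
      w A * h (card (A ∩ everything))
        ≡⟨ cong (λ B → w A * h (card B)) (∩-everything A) ⟩
      w A * h (card A)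
        ≤⟨ *-monoʳ-≤ (w A) (h≤2^half (card A)) ⟩
      w A * (2 ^ ⌊ card A /2⌋ * 4)
        ≡⟨ solve 2 (λ u p → u :* (p :* con 4) := p :* (u :* con 4)) refl (w A) (2 ^ ⌊ card A /2⌋) ⟩
      2 ^ ⌊ card A /2⌋ * (w A * 4) ∎)

  -- The real number d^(1/Δ) is represented by the fractions r / s not exceeding it. The conclusion
  -- says that the size is at least 2^(Δ (r / s) / 288), so c = 1/288.
  formula-size : ∀ k → 64 ≤ d → 2 ^ suc k ≤ d → (f : Formula F (d * (2 * 2))) →
    SynMultilinear F f → SigmaPiSigma F (suc k) f → Computes F f (IMM F d) →
    ∀ r s → 0 < s → r ^ suc k ≤ d * s ^ suc k → 2 ^ (suc k * r) ≤ size F f ^ (288 * s)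
  formula-size k 64≤d 2^Δ≤d f ml sps computes r s 0<s r^Δ≤ =
    conclude (large-exponent d k r s 64≤d 2^Δ≤d 0<s r^Δ≤)
    where
    S = size F f
    exponential : ∀ D → Need k d D → 2 ^ D ≤ 6 * S ^ 6
    exponential D need = pow-bound D S (size-bound ml sps computes D need)
    -- The saving D = 3 is available for every d ≥ 64 and rules out S ≤ 1; then the constant 6 can
    -- be absorbed into a power of `S`.
    2≤S : 2 ≤ S
    2≤S = size≥2 S (exponential 3 (need-intro k 1 3 d 3 (subst (λ z → 8 * (z * 8) ≤ d) (sym (^-zeroˡ (suc k))) 64≤d) ≤-refl))
    conclude : (Σ ℕ λ D → Need k d D × suc k * r ≤ 32 * s * D) → 2 ^ (suc k * r) ≤ S ^ (288 * s)
    conclude (D , need , Δr≤) = begin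
      2 ^ (suc k * r)      ≤⟨ ^-monoʳ-≤ 2 Δr≤ ⟩
      2 ^ (32 * s * D)     ≡⟨ cong (2 ^_) (*-comm (32 * s) D) ⟩
      2 ^ (D * (32 * s))   ≡⟨ sym (^-*-assoc 2 D (32 * s)) ⟩
      -- The exponent 288 is 9 · 32, with 9 from 2^D ≤ 6 S^6 ≤ S^9 and 32 from `large-exponent`.
      (2 ^ D) ^ (32 * s)   ≤⟨ ^-monoˡ-≤ (32 * s) (≤-trans (exponential D need) (6S^6≤S^9 2≤S)) ⟩
      (S ^ 9) ^ (32 * s)   ≡⟨ ^-*-assoc S 9 (32 * s) ⟩
      S ^ (9 * (32 * s))   ≡⟨ cong (S ^_) (sym (*-assoc 9 32 s)) ⟩
      S ^ (288 * s)        ∎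

open import Data.Nat using (_≤_; _<_; _*_; _^_; NonZero)

theorem3p1 : ∀ {a ℓ : Level} →
    Σ ℕ λ q → NonZero q × (Σ ℕ λ d₀ →
    ∀ (F : Field a ℓ) (d Δ : ℕ) → d₀ ≤ d → 1 ≤ Δ → 2 ^ Δ ≤ d →
    (f : Formula F (d * (2 * 2))) →
    SynMultilinear F f → SigmaPiSigma F Δ f → Computes F f (IMM F d) →
    ∀ (r s : ℕ) → 0 < s → r ^ Δ ≤ d * s ^ Δ →
    2 ^ (Δ * r) ≤ size F f ^ (q * s))
theorem3p1 = 288 , _ , 64 , λ F d → λ where
  (suc k) 64≤d _ 2^Δ≤d → Main.formula-size F d k 64≤d 2^Δ≤d
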